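{- Let $A$ be a finite alphabet of colors and $J$ a sentence over $A$. Then $\psi(\mathfrak{S}^*_J)=\mathfrak{RS}^*_J$.
   Context: Words are finite sequences of colors; a sentence is a finite sequence $I=(w_1,\dots,w_k)$ of nonempty words; $w(I)=w_1\cdots w_k$. $J\preceq I$ means $w(J)=w(I)$ and $I$ arises from $J$ by concatenating adjacent words. A sentence splits after its $i$-th letter if the $i$-th and $(i+1)$-th letters lie in different words; the complement $I^c$ is the unique sentence with $w(I^c)=w(I)$ splitting exactly at the positions where $I$ does not. Variables $x_{a,i}$ ($a\in A$, $i\ge1$) satisfy only $x_{a,i}x_{b,j}=x_{b,j}x_{a,i}$ for $i\ne j$; $x_{w,i}=x_{c_1,i}\cdots x_{c_r,i}$, $x_{\emptyset,i}=1$. $M_I=\sum_{j_1<\dots<j_k}x_{w_1,j_1}\cdots x_{w_k,j_k}$, $QSym_A=\mathrm{span}\{M_I\}$, $F_I=\sum_{J\preceq I}M_J$. $\psi:QSym_A\to QSym_A$ is the linear map with $\psi(F_I)=F_{I^c}$. For $J=(w_1,\dots,w_k)$ the colored composition diagram has $k$ left-justified rows (row 1 on top), row $i$ with $|w_i|$ boxes colored in order by the letters of $w_i$. A colored immaculate tableau (CIT) of shape $J$ fills it with positive integers weakly increasing left to right in rows and strictly increasing top to bottom in the first column; its type is $(u_1,\dots,u_m)$ with $u_i$ the colors of boxes containing $i$ read from the lowest row to the highest, left to right within rows; $x_T=x_{u_1,1}\cdots x_{u_m,m}$; $\mathfrak{S}^*_J=\sum_T x_T$ over all CIT of shape $J$.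 A colored row-strict immaculate tableau (CRSIT) of shape $J$ fills the diagram with positive integers strictly increasing left to right in each row and weakly increasing top to bottom in the first column; its type is $(u_1,\dots,u_m)$ with $u_i$ the colors of the boxes containing $i$ read left to right and top to bottom (rows from top to bottom); $x_T=x_{u_1,1}\cdots x_{u_m,m}$. The colored row-strict dual immaculate function is $\mathfrak{RS}^*_J=\sum_T x_T$ over all CRSIT of shape $J$. -}

module Defs where

open import Data.Nat as ℕ using (ℕ; zero; suc; _≤ᵇ_; _<ᵇ_; _≡ᵇ_)
open import Data.Integer as ℤ using (ℤ; +_)
open import Data.Fin using (Fin) renaming (_≟_ to _≟ᶠ_)
open import Data.Bool using (Bool; true; false; if_then_else_; _∧_; not)
open import Data.List using (List; []; _∷_; _++_; map; concatMap; length; reverse; foldr; zip; applyUpTo)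
open import Data.List.NonEmpty using (List⁺; _∷_; toList)
open import Data.List.Properties using (≡-dec)
open import Data.Product using (_×_; _,_)
open import Relation.Nullary.Decidable using (⌊_⌋)
open import Relation.Binary.PropositionalEquality using (_≡_)

Word : ℕ → Set
Word n = List (Fin n)

Sentence : ℕ → Set
Sentence n = List (List⁺ (Fin n))

sentenceWords : ∀ {n} → Sentence n → List (Word n)
sentenceWords = map toList

-- Monomials and (formal power) series
-- A monomial of the partially commutative algebra (x_{a,i} x_{b,j} = x_{b,j} x_{a,i}
-- for i ≠ j) is determined by the word of colours carried by each index i.
-- The list (v₁, …, vₘ) represents x_{v₁,1} x_{v₂,2} ⋯ x_{vₘ,m}
-- (empty words allowed; trailing empty words do not change the monomial).
Monomial : ℕ → Set
Monomial n = List (Word n)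

Series : ℕ → Set
Series n = Monomial n → ℤ

_≋_ : ∀ {n} → Series n → Series n → Set
f ≋ g = ∀ v → f v ≡ g v

infix 4 _≋_

nonemptyParts : ∀ {n} → Monomial n → List (Word n)
nonemptyParts [] = []
nonemptyParts ([] ∷ vs) = nonemptyParts vs
nonemptyParts ((a ∷ w) ∷ vs) = (a ∷ w) ∷ nonemptyParts vs

-- M_I = Σ_{j₁<⋯<j_k} x_{w₁,j₁} ⋯ x_{w_k,j_k}: coefficient 1 exactly at
-- the monomials whose nonempty parts (in index order) are w₁,…,w_k
M : ∀ {n} → Sentence n → Series n
M I v = if ⌊ ≡-dec (≡-dec _≟ᶠ_) (nonemptyParts v) (sentenceWords I) ⌋ then + 1 else + 0

cuts : ∀ {n} → Fin n → Word n → List (Sentence n)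
cuts a [] = ((a ∷ []) ∷ []) ∷ []
cuts a (b ∷ bs) = concatMap step (cuts b bs)
  where
  step : Sentence _ → List (Sentence _)
  step [] = []
  step ((c ∷ cs) ∷ rest) = ((a ∷ []) ∷ (c ∷ cs) ∷ rest) ∷ ((a ∷ c ∷ cs) ∷ rest) ∷ []

refinements : ∀ {n} → Sentence n → List (Sentence n)
refinements [] = [] ∷ []
refinements ((a ∷ as) ∷ I) =
  concatMap (λ p → map (p ++_) (refinements I)) (cuts a as)

sumℤ : List ℤ → ℤ
sumℤ = foldr ℤ._+_ (+ 0)

F : ∀ {n} → Sentence n → Series n
F I v = sumℤ (map (λ J → M J v) (refinements I))

-- letters marked with "the sentence splits after this letter"
-- (the last letter of each word is marked true)
toMarked : ∀ {n} → Sentence n → List (Fin n × Bool)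
toMarked [] = []
toMarked ((a ∷ as) ∷ I) = mark a as ++ toMarked I
  where
  mark : _ → List _ → List _
  mark a [] = (a , true) ∷ []
  mark a (b ∷ bs) = (a , false) ∷ mark b bs

fromMarked : ∀ {n} → List (Fin n × Bool) → Sentence n
fromMarked [] = []
fromMarked ((a , true) ∷ r) = (a ∷ []) ∷ fromMarked r
fromMarked ((a , false) ∷ r) with fromMarked r
... | [] = (a ∷ []) ∷ []
... | (w ∷ I) = (a ∷ toList w) ∷ I

flipButLast : ∀ {n} → List (Fin n × Bool) → List (Fin n × Bool)
flipButLast [] = []
flipButLast (x ∷ []) = x ∷ []
flipButLast ((a , b) ∷ rest@(_ ∷ _)) = (a , not b) ∷ flipButLast rest

complement : ∀ {n} → Sentence n → Sentence n
complement I = fromMarked (flipButLast (toMarked I))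

LinComb : ℕ → Set
LinComb n = List (ℤ × Sentence n)

evalF : ∀ {n} → LinComb n → Series n
evalF cs v = sumℤ (map (λ { (c , I) → c ℤ.* F I v }) cs)

ψ : ∀ {n} → LinComb n → LinComb n
ψ = map (λ { (c , I) → (c , complement I) })

-- a filling: one list of entries per row (row 1 on top)
Filling : Set
Filling = List (List ℕ)

weakIncr : List ℕ → Bool
weakIncr [] = true
weakIncr (_ ∷ []) = true
weakIncr (a ∷ r@(b ∷ _)) = (a ≤ᵇ b) ∧ weakIncr r

strictIncr : List ℕ → Bool
strictIncr [] = true
strictIncr (_ ∷ []) = true
strictIncr (a ∷ r@(b ∷ _)) = (a <ᵇ b) ∧ strictIncr r

allB : {X : Set} → (X → Bool) → List X → Bool
allB p = foldr (λ x b → p x ∧ b) true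

firstColumn : Filling → List ℕ
firstColumn [] = []
firstColumn ([] ∷ T) = firstColumn T
firstColumn ((e ∷ _) ∷ T) = e ∷ firstColumn T

hasShape : ∀ {n} → Sentence n → Filling → Bool
hasShape J T = ⌊ ≡-dec ℕ._≟_ (map length T) (map (λ w → length (toList w)) J) ⌋

positive : Filling → Bool
positive = allB (allB (1 ≤ᵇ_))

isCIT : ∀ {n} → Sentence n → Filling → Bool
isCIT J T = hasShape J T ∧ positive T ∧ allB weakIncr T ∧ strictIncr (firstColumn T)

isCRSIT : ∀ {n} → Sentence n → Filling → Bool
isCRSIT J T = hasShape J T ∧ positive T ∧ allB strictIncr T ∧ weakIncr (firstColumn T)

coloredRows : ∀ {n} → Sentence n → Filling → List (List (Fin n × ℕ))
coloredRows [] _ = []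
coloredRows (_ ∷ _) [] = []
coloredRows (w ∷ J) (r ∷ T) = zip (toList w) r ∷ coloredRows J T

coloursOf : ∀ {n} → ℕ → List (List (Fin n × ℕ)) → Word n
coloursOf i = concatMap (concatMap (λ { (c , e) → if e ≡ᵇ i then c ∷ [] else [] }))

typeUpTo : ∀ {n} → ℕ → List (List (Fin n × ℕ)) → Monomial n
typeUpTo m rs = applyUpTo (λ k → coloursOf (suc k) rs) m

typeCIT : ∀ {n} → ℕ → Sentence n → Filling → Monomial n
typeCIT m J T = typeUpTo m (reverse (coloredRows J T))

typeCRSIT : ∀ {n} → ℕ → Sentence n → Filling → Monomial n
typeCRSIT m J T = typeUpTo m (coloredRows J T)

rowsUpTo : ℕ → ℕ → List (List ℕ)
rowsUpTo zero m = [] ∷ []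
rowsUpTo (suc l) m = concatMap (λ e → map (e ∷_) (rowsUpTo l m)) (applyUpTo suc m)

fillingsUpTo : ∀ {n} → Sentence n → ℕ → List Filling
fillingsUpTo [] m = [] ∷ []
fillingsUpTo (w ∷ J) m =
  concatMap (λ r → map (r ∷_) (fillingsUpTo J m)) (rowsUpTo (length (toList w)) m)

count : {X : Set} → (X → Bool) → List X → ℕ
count p [] = 0
count p (x ∷ xs) = if p x then suc (count p xs) else count p xs

eqMon : ∀ {n} → Monomial n → Monomial n → Bool
eqMon u v = ⌊ ≡-dec (≡-dec _≟ᶠ_) u v ⌋

-- Coefficient of x_{v₁,1}⋯x_{vₘ,m} in 𝔖*_J = Σ_T x_T : the number of CIT T of shape J
-- with x_T equal to that monomial.  Such T have all entries ≤ m (an entry i > m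
-- would make the i-th part of the type nonempty), so it suffices to enumerate
-- fillings with entries in {1,…,m} and compare (u₁,…,uₘ) with (v₁,…,vₘ).
dualImm : ∀ {n} → Sentence n → Series n
dualImm J v = + count (λ T → isCIT J T ∧ eqMon (typeCIT (length v) J T) v)
                      (fillingsUpTo J (length v))

rowStrictDualImm : ∀ {n} → Sentence n → Series n
rowStrictDualImm J v = + count (λ T → isCRSIT J T ∧ eqMon (typeCRSIT (length v) J T) v)
                               (fillingsUpTo J (length v))

{-# OPTIONS --safe #-}
module Submission where

-- A filling is read in the order of its entries, equal entries being ordered as in the type.
-- Each CIT, and each CRSIT, then becomes a standard tableau, encoded as the coloured word of
-- its boxes in which a letter is marked when the next box lies in a strictly lower row (a
-- descent).  A CIT must separate the values at descents and a CRSIT exactly at non-descents, so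
-- the same standard tableaux expand 𝔖*_J into the F_I and ℜ𝔖*_J into the F_{I^c}.  Both
-- expansions are proved by removing the top row: the standard tableaux of w ∷ J are the shuffles
-- of w with those of J that begin with the first letter of w.
--
-- That the result does not depend on how 𝔖*_J is written in the F_I needs no linear independence:
-- by inclusion–exclusion, F_{I^c}(v) is a signed sum of values F_I(u), with signs and monomials u
-- depending on v only, so ψ is induced by a linear operator on all series.

open import Defs
open import Data.Nat using (ℕ; zero; suc; _+_; _*_; _≤_; _<_; z≤n; s≤s; _≤ᵇ_; _<ᵇ_; _≡ᵇ_)
open import Data.Nat.Properties
  using (+-identityʳ; +-comm; *-identityˡ; *-zeroʳ; *-comm; *-distribˡ-+; suc-injective;
         ≤-refl; ≤-trans; <-≤-trans; <⇒≤; ≤⇒≯; ≤-<-connex;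
         ≤ᵇ⇒≤; ≤⇒≤ᵇ; <ᵇ⇒<; <⇒<ᵇ; ≡ᵇ⇒≡; ≡⇒≡ᵇ)
open import Data.Nat.ListAction using (sum)
open import Data.Nat.ListAction.Properties using (sum-++)
open import Data.Nat.Tactic.RingSolver using (solve-∀)
open import Data.Integer as ℤ using (ℤ) renaming (+_ to pos)
import Data.Integer.Properties as ℤₚ
import Data.Integer.Tactic.RingSolver as ℤ-Solver
open import Data.Fin using (Fin) renaming (_≟_ to _≟ᶠ_)
open import Data.Bool using (Bool; true; false; if_then_else_; _∧_; not; T)
open import Data.Bool.Properties using (∧-comm; ∧-zeroʳ; T-∧)
open import Data.Empty using (⊥-elim)
open import Data.Unit using (tt)
open import Data.List
  using (List; []; _∷_; _++_; map; concatMap; length; reverse; applyUpTo; zip; upTo)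
open import Data.List.NonEmpty using (List⁺; _∷_; toList)
open import Data.List.Properties
  using (≡-dec; map-++; map-∘; map-upTo; concatMap-++; unfold-reverse; ++-identityʳ;
         ++-conicalˡ; ++-conicalʳ; ∷-injective)
open import Data.List.Relation.Unary.All as All using (All; []; _∷_)
open import Data.List.Relation.Unary.All.Properties using (concat⁺; map⁺; applyUpTo⁺₁)
open import Data.Product using (Σ-syntax; _×_; _,_; proj₁; proj₂)
open import Data.Sum using (_⊎_; inj₁; inj₂)
open import Function using (_∘_; _⇔_; mk⇔; Equivalence)
open import Relation.Nullary using (Dec; does; yes; no; ¬_)
open import Relation.Nullary.Decidable
  using (⌊_⌋; isYes≗does; does-⇔; toWitness; fromWitness; dec-true; dec-false)
open import Relation.Binary.PropositionalEquality
open ≡-Reasoning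

private variable
  n : ℕ
  X Y : Set

-- Finite sums of natural numbers

∑ : List X → (X → ℕ) → ℕ
∑ xs f = sum (map f xs)

∑-cong : {f g : X → ℕ} (xs : List X) → All (λ x → f x ≡ g x) xs → ∑ xs f ≡ ∑ xs g
∑-cong [] [] = refl
∑-cong (x ∷ xs) (p ∷ ps) = cong₂ _+_ p (∑-cong xs ps)

∑-ext : {f g : X → ℕ} (xs : List X) → (∀ x → f x ≡ g x) → ∑ xs f ≡ ∑ xs g
∑-ext xs p = ∑-cong xs (All.universal p xs)

∑-zero : (xs : List X) → ∑ xs (λ _ → 0) ≡ 0
∑-zero [] = refl
∑-zero (x ∷ xs) = ∑-zero xs

∑-++ : (f : X → ℕ) (xs ys : List X) → ∑ (xs ++ ys) f ≡ ∑ xs f + ∑ ys f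
∑-++ f xs ys = trans (cong sum (map-++ f xs ys)) (sum-++ (map f xs) (map f ys))

∑-map : (h : X → Y) (f : Y → ℕ) (xs : List X) → ∑ (map h xs) f ≡ ∑ xs (f ∘ h)
∑-map h f xs = cong sum (sym (map-∘ xs))

∑-concatMap : (h : X → List Y) (f : Y → ℕ) (xs : List X) →
  ∑ (concatMap h xs) f ≡ ∑ xs (λ x → ∑ (h x) f)
∑-concatMap h f [] = refl
∑-concatMap h f (x ∷ xs) =
  trans (∑-++ f (h x) (concatMap h xs)) (cong (∑ (h x) f +_) (∑-concatMap h f xs))

interchange : ∀ a b c d → (a + b) + (c + d) ≡ (a + c) + (b + d)
interchange = solve-∀

∑-*ˡ : (c : ℕ) (f : X → ℕ) (xs : List X) → ∑ xs (λ x → c * f x) ≡ c * ∑ xs f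
∑-*ˡ c f [] = sym (*-zeroʳ c)
∑-*ˡ c f (x ∷ xs) =
  trans (cong (c * f x +_) (∑-*ˡ c f xs)) (sym (*-distribˡ-+ c (f x) (∑ xs f)))

𝟙 : Bool → ℕ
𝟙 true = 1
𝟙 false = 0

𝟙-∧ : ∀ x y → 𝟙 (x ∧ y) ≡ 𝟙 x * 𝟙 y
𝟙-∧ true y = sym (*-identityˡ (𝟙 y))
𝟙-∧ false y = refl

count-∑ : (p : X → Bool) (xs : List X) → count p xs ≡ ∑ xs (𝟙 ∘ p)
count-∑ p [] = refl
count-∑ p (x ∷ xs) with p x
... | true = cong suc (count-∑ p xs)
... | false = count-∑ p xs

-- Marked words and the monomials compatible with them

infix 4 _==ʷ_ _==ᵐ_

_==ʷ_ : Word n → Word n → Bool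
u ==ʷ v = does (≡-dec _≟ᶠ_ u v)

_==ᵐ_ : Monomial n → Monomial n → Bool
u ==ᵐ v = does (≡-dec (≡-dec _≟ᶠ_) u v)

MarkedWord : ℕ → Set
MarkedWord n = List (Fin n × Bool)

agrees : Bool → Bool → Bool
agrees true b = b
agrees false b = not b

-- A marked word s stands for a standard tableau read in order, a letter being marked when the
-- next one lies in a strictly lower row.  With b = false, marked letters (descents) end a block
-- of the monomial; with b = true, unmarked ones do.  The mark of the last letter is irrelevant.
compatible : Bool → MarkedWord n → Monomial n → Bool
compatible b s ([] ∷ v) = compatible b s v
compatible b [] [] = true
compatible b (_ ∷ _) [] = false
compatible b [] ((_ ∷ _) ∷ v) = false
compatible b ((c , k) ∷ s) ((a ∷ []) ∷ v) = does (c ≟ᶠ a) ∧ compatible b s v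
compatible b ((c , k) ∷ s) ((a ∷ a' ∷ u) ∷ v) =
  does (c ≟ᶠ a) ∧ (agrees k b ∧ compatible b s ((a' ∷ u) ∷ v))

-- The local function `mark` of toMarked has no name outside Defs; it is recovered here by
-- unification, the with-abstraction separating its parameters from its arguments.
mutual
  markLetters : Fin n → Word n → Sentence n → Fin n → Word n → MarkedWord n
  markLetters = _

  toMarked-markLetters : (a b : Fin n) (bs : Word n) (I : Sentence n) →
    toMarked ((a ∷ b ∷ bs) ∷ I) ≡ (a , false) ∷ (markLetters a (b ∷ bs) I b bs ++ toMarked I)
  toMarked-markLetters a b bs I with b List.∷ bs
  ... | z = refl

-- Peeling a letter off a word compares two instances of the local function that inherit different
-- parameters from their clauses.
markLetters-irr : (a a' : Fin n) (as as' : Word n) (I I' : Sentence n) (b : Fin n) (bs : Word n) →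
  markLetters a as I b bs ≡ markLetters a' as' I' b bs
markLetters-irr a a' as as' I I' b [] = refl
markLetters-irr a a' as as' I I' b (c ∷ bs) =
  cong ((b , false) ∷_) (markLetters-irr a a' as as' I I' c bs)

toMarked-∷ : (a b : Fin n) (bs : Word n) (I : Sentence n) →
  toMarked ((a ∷ b ∷ bs) ∷ I) ≡ (a , false) ∷ toMarked ((b ∷ bs) ∷ I)
toMarked-∷ a b bs I =
  cong (λ s → (a , false) ∷ (s ++ toMarked I)) (markLetters-irr a b (b ∷ bs) bs I I b bs)

parts : Monomial n → Sentence n
parts [] = []
parts ([] ∷ v) = parts v
parts ((a ∷ u) ∷ v) = (a ∷ u) ∷ parts v

sentenceWords-parts : (v : Monomial n) → sentenceWords (parts v) ≡ nonemptyParts v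
sentenceWords-parts [] = refl
sentenceWords-parts ([] ∷ v) = sentenceWords-parts v
sentenceWords-parts ((a ∷ u) ∷ v) = cong ((a ∷ u) ∷_) (sentenceWords-parts v)

-- `M` reads a monomial only through its nonempty parts, so compatibility has to be transferable to
-- them.
compatible-nonemptyParts : ∀ b (s : MarkedWord n) v →
  compatible b s (nonemptyParts v) ≡ compatible b s v
compatible-nonemptyParts b s [] = refl
compatible-nonemptyParts b s ([] ∷ v) = compatible-nonemptyParts b s v
compatible-nonemptyParts b [] ((a ∷ u) ∷ v) = refl
compatible-nonemptyParts b ((c , k) ∷ s) ((a ∷ []) ∷ v) =
  cong (does (c ≟ᶠ a) ∧_) (compatible-nonemptyParts b s v)
compatible-nonemptyParts b ((c , k) ∷ s) ((a ∷ a' ∷ u) ∷ v) =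
  cong (λ x → does (c ≟ᶠ a) ∧ (agrees k b ∧ x)) (compatible-nonemptyParts b s ((a' ∷ u) ∷ v))

-- A mark is consulted only when the block continues, and after the last letter a continuing block
-- fails anyway.
compatible-last : ∀ b k k' (c : Fin n) v →
  compatible b ((c , k) ∷ []) v ≡ compatible b ((c , k') ∷ []) v
compatible-last b k k' c [] = refl
compatible-last b k k' c ([] ∷ v) = compatible-last b k k' c v
compatible-last b k k' c ((a ∷ []) ∷ v) = refl
compatible-last b k k' c ((a ∷ a' ∷ u) ∷ v) with does (c ≟ᶠ a)
... | false = refl
... | true = trans (∧-zeroʳ (agrees k b)) (sym (∧-zeroʳ (agrees k' b)))

compatible-∷ : ∀ b (x : Fin n × Bool) {s s' : MarkedWord n} →
  (∀ v → compatible b s v ≡ compatible b s' v) →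
  ∀ v → compatible b (x ∷ s) v ≡ compatible b (x ∷ s') v
compatible-∷ b x p [] = refl
compatible-∷ b x p ([] ∷ v) = compatible-∷ b x p v
compatible-∷ b (c , k) p ((a ∷ []) ∷ v) = cong (does (c ≟ᶠ a) ∧_) (p v)
compatible-∷ b (c , k) p ((a ∷ a' ∷ u) ∷ v) =
  cong (λ y → does (c ≟ᶠ a) ∧ (agrees k b ∧ y)) (p ((a' ∷ u) ∷ v))

-- Negating the marks exchanges the two agreement conditions; the last mark, which `flipButLast`
-- keeps, is never decisive.
compatible-flip : (s : MarkedWord n) (v : Monomial n) →
  compatible false (flipButLast s) v ≡ compatible true s v
compatible-flip s ([] ∷ v) = compatible-flip s v
compatible-flip [] [] = refl
compatible-flip (_ ∷ []) [] = refl
compatible-flip (_ ∷ _ ∷ _) [] = refl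
compatible-flip [] ((_ ∷ _) ∷ v) = refl
compatible-flip (x ∷ []) ((a ∷ []) ∷ v) = cong (_ ∧_) (compatible-flip [] v)
compatible-flip ((c , k) ∷ []) ((a ∷ a' ∷ u) ∷ v) with does (c ≟ᶠ a) | k
... | false | _ = refl
... | true | false = refl
... | true | true = refl
compatible-flip (x ∷ s@(_ ∷ _)) ((a ∷ []) ∷ v) = cong (_ ∧_) (compatible-flip s v)
compatible-flip ((c , k) ∷ s@(_ ∷ _)) ((a ∷ a' ∷ u) ∷ v) =
  cong₂ (λ x y → does (c ≟ᶠ a) ∧ (x ∧ y)) (agrees-not k) (compatible-flip s ((a' ∷ u) ∷ v))
  where
  agrees-not : ∀ k → agrees (not k) false ≡ agrees k true
  agrees-not true = refl
  agrees-not false = refl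

fromMarked-[] : (s : MarkedWord n) → fromMarked s ≡ [] → s ≡ []
fromMarked-[] [] p = refl
fromMarked-[] ((a , false) ∷ s) p with fromMarked s
fromMarked-[] ((a , false) ∷ s) () | []
fromMarked-[] ((a , false) ∷ s) () | _ ∷ _

-- The round trip can change only the last mark: `fromMarked` closes the final word whatever that
-- mark is, and `toMarked` then sets it to `true`.
compatible-toMarked-fromMarked : ∀ b (s : MarkedWord n) v →
  compatible b (toMarked (fromMarked s)) v ≡ compatible b s v
compatible-toMarked-fromMarked b [] v = refl
compatible-toMarked-fromMarked b ((a , true) ∷ s) v =
  compatible-∷ b (a , true) (compatible-toMarked-fromMarked b s) v
compatible-toMarked-fromMarked b ((a , false) ∷ s) v
  with fromMarked s in eq | compatible-toMarked-fromMarked b s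
... | [] | _ rewrite fromMarked-[] s eq = compatible-last b true false a v
... | (c ∷ cs) ∷ I | ih =
  trans (cong (λ t → compatible b t v) (toMarked-∷ a c cs I)) (compatible-∷ b (a , false) ih v)

-- Refinements and the coefficients of F_I

data NonNull {X : Set} : List X → Set where
  nonNull : ∀ {x xs} → NonNull (x ∷ xs)

-- The local `step` of `cuts` discards an empty sentence; since none occurs, every cut of a word
-- extends in exactly two ways to a word with one more letter.
cuts-nonNull : (a : Fin n) (as : Word n) → All NonNull (cuts a as)
cuts-nonNull a [] = nonNull ∷ []
cuts-nonNull {n} a (b ∷ bs) = concat⁺ (map⁺ (All.map split (cuts-nonNull b bs)))
  where
  split : ∀ {p} → NonNull p → _
  split {(c ∷ cs) ∷ p} nonNull = nonNull ∷ nonNull ∷ []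

attach : Fin n → Sentence n → Sentence n
attach a [] = []
attach a ((c ∷ cs) ∷ p) = (a ∷ c ∷ cs) ∷ p

∑-cuts : (a b : Fin n) (bs : Word n) (f : Sentence n → ℕ) →
  ∑ (cuts a (b ∷ bs)) f ≡ ∑ (cuts b bs) (λ p → f ((a ∷ []) ∷ p) + f (attach a p))
∑-cuts {n} a b bs f =
  trans (∑-concatMap _ f (cuts b bs)) (∑-cong (cuts b bs) (All.map split (cuts-nonNull b bs)))
  where
  split : ∀ {p} → NonNull p → _
  split {(c ∷ cs) ∷ p} nonNull =
    cong (f ((a ∷ []) ∷ (c ∷ cs) ∷ p) +_) (+-identityʳ (f ((a ∷ c ∷ cs) ∷ p)))

infix 4 _==ˢ_

_==ˢ_ : Sentence n → Sentence n → Bool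
J ==ˢ K = sentenceWords J ==ᵐ sentenceWords K

module _ (I : Sentence n) where

  private
    matches : Sentence n → Sentence n → ℕ
    matches K p = ∑ (refinements I) (λ J → 𝟙 ((p ++ J) ==ˢ K))

  matches-[] : ∀ {p} → NonNull p → matches [] p ≡ 0
  matches-[] nonNull = ∑-zero (refinements I)

  matches-single : ∀ a x K p →
    matches ((x ∷ []) ∷ K) ((a ∷ []) ∷ p) ≡ 𝟙 (does (a ≟ᶠ x)) * matches K p
  matches-single a x K p with does (a ≟ᶠ x)
  ... | true = sym (*-identityˡ (matches K p))
  ... | false = ∑-zero (refinements I)

  matches-single-long : ∀ a x x' u K p → matches ((x ∷ x' ∷ u) ∷ K) ((a ∷ []) ∷ p) ≡ 0
  matches-single-long a x x' u K p with does (a ≟ᶠ x)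
  ... | true = ∑-zero (refinements I)
  ... | false = ∑-zero (refinements I)

  matches-attach-single : ∀ a x K {p} → NonNull p → matches ((x ∷ []) ∷ K) (attach a p) ≡ 0
  matches-attach-single a x K {(c ∷ cs) ∷ p} nonNull with does (a ≟ᶠ x)
  ... | true = ∑-zero (refinements I)
  ... | false = ∑-zero (refinements I)

  matches-attach : ∀ a x x' u K {p} → NonNull p →
    matches ((x ∷ x' ∷ u) ∷ K) (attach a p) ≡ 𝟙 (does (a ≟ᶠ x)) * matches ((x' ∷ u) ∷ K) p
  matches-attach a x x' u K {(c ∷ cs) ∷ p} nonNull with does (a ≟ᶠ x)
  ... | true = sym (*-identityˡ (matches ((x' ∷ u) ∷ K) ((c ∷ cs) ∷ p)))
  ... | false = ∑-zero (refinements I)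

  -- Of the two choices after each letter, to split or to attach, only one can agree with `K`,
  -- according to whether the first word of `K` ends there. Hence at most one refinement matches.
  refineFirst : (∀ K → matches K [] ≡ 𝟙 (compatible false (toMarked I) (sentenceWords K))) →
    ∀ a as K →
    ∑ (cuts a as) (matches K) ≡ 𝟙 (compatible false (toMarked ((a ∷ as) ∷ I)) (sentenceWords K))
  refineFirst ih a [] [] = trans (+-identityʳ _) (matches-[] {(a ∷ []) ∷ []} nonNull)
  refineFirst ih a [] ((x ∷ []) ∷ K) = begin
    matches ((x ∷ []) ∷ K) ((a ∷ []) ∷ []) + 0 ≡⟨ +-identityʳ _ ⟩
    matches ((x ∷ []) ∷ K) ((a ∷ []) ∷ [])     ≡⟨ matches-single a x K [] ⟩
    𝟙 (does (a ≟ᶠ x)) * matches K []           ≡⟨ cong (𝟙 (does (a ≟ᶠ x)) *_) (ih K) ⟩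
    𝟙 (does (a ≟ᶠ x)) * 𝟙 (compatible false (toMarked I) (sentenceWords K))
      ≡⟨ 𝟙-∧ (does (a ≟ᶠ x)) _ ⟨
    𝟙 (does (a ≟ᶠ x) ∧ compatible false (toMarked I) (sentenceWords K)) ∎
  -- The first word of the refined sentence ends here, so `K` cannot continue its own.
  refineFirst ih a [] ((x ∷ x' ∷ u) ∷ K) =
    trans (+-identityʳ _) (trans (matches-single-long a x x' u K []) (vanish (does (a ≟ᶠ x))))
    where
    vanish : ∀ d → 0 ≡ 𝟙 (d ∧ false)
    vanish true = refl
    vanish false = refl
  refineFirst ih a (b ∷ bs) K rewrite toMarked-∷ a b bs I =
    trans (∑-cuts a b bs (matches K)) (twoLetters K)
    where
    s = toMarked ((b ∷ bs) ∷ I)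
    fs = λ K p → matches K ((a ∷ []) ∷ p) + matches K (attach a p)
    twoLetters : ∀ K →
      ∑ (cuts b bs) (fs K) ≡ 𝟙 (compatible false ((a , false) ∷ s) (sentenceWords K))
    scale : ∀ K K' x →
      (∀ {p} → NonNull p → fs K p ≡ 𝟙 (does (a ≟ᶠ x)) * matches K' p) →
      ∑ (cuts b bs) (fs K) ≡ 𝟙 (does (a ≟ᶠ x) ∧ compatible false s (sentenceWords K'))
    scale K K' x p = begin
      ∑ (cuts b bs) (fs K)
        ≡⟨ ∑-cong (cuts b bs) (All.map p (cuts-nonNull b bs)) ⟩
      ∑ (cuts b bs) (λ p → 𝟙 (does (a ≟ᶠ x)) * matches K' p)
        ≡⟨ ∑-*ˡ (𝟙 (does (a ≟ᶠ x))) (matches K') (cuts b bs) ⟩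
      𝟙 (does (a ≟ᶠ x)) * ∑ (cuts b bs) (matches K')
        ≡⟨ cong (𝟙 (does (a ≟ᶠ x)) *_) (refineFirst ih b bs K') ⟩
      𝟙 (does (a ≟ᶠ x)) * 𝟙 (compatible false s (sentenceWords K'))
        ≡⟨ 𝟙-∧ (does (a ≟ᶠ x)) _ ⟨
      𝟙 (does (a ≟ᶠ x) ∧ compatible false s (sentenceWords K')) ∎
    attached : ∀ {p} → NonNull p → NonNull (attach a p)
    attached {(c ∷ cs) ∷ p} nonNull = nonNull
    twoLetters [] = trans
      (∑-cong (cuts b bs) (All.map (λ {p} nn →
        cong₂ _+_ (matches-[] {(a ∷ []) ∷ p} nonNull) (matches-[] (attached nn)))
        (cuts-nonNull b bs)))
      (∑-zero (cuts b bs))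
    twoLetters ((x ∷ []) ∷ K) = scale ((x ∷ []) ∷ K) K x (λ {p} nn →
      trans (cong₂ _+_ (matches-single a x K p) (matches-attach-single a x K nn)) (+-identityʳ _))
    twoLetters ((x ∷ x' ∷ u) ∷ K) = scale ((x ∷ x' ∷ u) ∷ K) ((x' ∷ u) ∷ K) x (λ {p} nn →
      cong₂ _+_ (matches-single-long a x x' u K p) (matches-attach a x x' u K nn))

refinements-compatible : (I K : Sentence n) →
  ∑ (refinements I) (λ J → 𝟙 (J ==ˢ K)) ≡ 𝟙 (compatible false (toMarked I) (sentenceWords K))
refinements-compatible [] [] = refl
refinements-compatible [] ((a ∷ u) ∷ K) = refl
refinements-compatible ((a ∷ as) ∷ I) K = trans (∑-concatMap _ _ (cuts a as))
  (trans (∑-ext (cuts a as) (λ p → ∑-map (p ++_) (λ J → 𝟙 (J ==ˢ K)) (refinements I)))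
         (refineFirst I (refinements-compatible I) a as K))

sumℤ-pos : {f : X → ℤ} (g : X → ℕ) (xs : List X) → (∀ x → f x ≡ pos (g x)) →
  sumℤ (map f xs) ≡ pos (∑ xs g)
sumℤ-pos g [] p = refl
sumℤ-pos g (x ∷ xs) p = trans (cong₂ ℤ._+_ (p x) (sumℤ-pos g xs p)) (sym (ℤₚ.pos-+ (g x) (∑ xs g)))

M-𝟙 : (J : Sentence n) (v : Monomial n) → M J v ≡ pos (𝟙 (J ==ˢ parts v))
M-𝟙 J v = trans (indicator ⌊ d ⌋)
  (cong (pos ∘ 𝟙) (trans (isYes≗does d) (does-⇔ (mk⇔ swap swap⁻¹) d d')))
  where
  d = ≡-dec (≡-dec _≟ᶠ_) (nonemptyParts v) (sentenceWords J)
  d' = ≡-dec (≡-dec _≟ᶠ_) (sentenceWords J) (sentenceWords (parts v))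
  swap : nonemptyParts v ≡ sentenceWords J → sentenceWords J ≡ sentenceWords (parts v)
  swap p = trans (sym p) (sym (sentenceWords-parts v))
  swap⁻¹ : sentenceWords J ≡ sentenceWords (parts v) → nonemptyParts v ≡ sentenceWords J
  swap⁻¹ p = trans (sym (sentenceWords-parts v)) (sym p)
  indicator : ∀ b → (if b then pos 1 else pos 0) ≡ pos (𝟙 b)
  indicator true = refl
  indicator false = refl

-- The coefficient counts the refinements of `I` equal to `parts v`; there is one exactly when the
-- letters agree and every split of `I` is a split of `v`.
F-compatible : (I : Sentence n) (v : Monomial n) →
  F I v ≡ pos (𝟙 (compatible false (toMarked I) v))
F-compatible I v = begin
  F I v
    ≡⟨ sumℤ-pos (λ J → 𝟙 (J ==ˢ parts v)) (refinements I) (λ J → M-𝟙 J v) ⟩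
  pos (∑ (refinements I) (λ J → 𝟙 (J ==ˢ parts v)))
    ≡⟨ cong pos (refinements-compatible I (parts v)) ⟩
  pos (𝟙 (compatible false (toMarked I) (sentenceWords (parts v))))
    ≡⟨ cong (λ u → pos (𝟙 (compatible false (toMarked I) u))) (sentenceWords-parts v) ⟩
  pos (𝟙 (compatible false (toMarked I) (nonemptyParts v)))
    ≡⟨ cong (pos ∘ 𝟙) (compatible-nonemptyParts false (toMarked I) v) ⟩
  pos (𝟙 (compatible false (toMarked I) v)) ∎

-- The marked word stays that of `I` and only the Boolean changes, so ψ becomes the passage from
-- `false` to `true`.
F-complement : (I : Sentence n) (v : Monomial n) →
  F (complement I) v ≡ pos (𝟙 (compatible true (toMarked I) v))
F-complement I v = trans (F-compatible (complement I) v) (cong (pos ∘ 𝟙)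
  (trans (compatible-toMarked-fromMarked false (flipButLast (toMarked I)) v)
         (compatible-flip (toMarked I) v)))

-- The operator induced by ψ

-- The linear operator induced by ψ on series.  Each position inside a block of the monomial
-- contributes the term that splits there minus the term that does not, since
-- [i ∈ S] = 1 − [i ∉ S].
mutual
  Ψ : Series n → Series n
  Ψ f [] = f []
  Ψ f ([] ∷ v) = Ψ (λ t → f ([] ∷ t)) v
  Ψ f ((a ∷ u) ∷ v) = Ψ-block a u (λ c w t → f ((c ∷ w) ∷ t)) v

  -- The block is handed to `f` as first letter and tail, which keeps it nonempty throughout the
  -- recursion.
  Ψ-block : Fin n → Word n → (Fin n → Word n → Series n) → Series n
  Ψ-block a [] f v = Ψ (f a []) v
  Ψ-block a (b ∷ u) f v =
    Ψ-block b u (λ c w t → f a [] ((c ∷ w) ∷ t)) v ℤ.- Ψ-block b u (λ c w t → f a (c ∷ w) t) v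

mutual
  Ψ-cong : {f g : Series n} → f ≋ g → Ψ f ≋ Ψ g
  Ψ-cong p [] = p []
  Ψ-cong p ([] ∷ v) = Ψ-cong (λ t → p ([] ∷ t)) v
  Ψ-cong p ((a ∷ u) ∷ v) = Ψ-block-cong a u (λ c w t → p ((c ∷ w) ∷ t)) v

  Ψ-block-cong : ∀ a u {f g : Fin n → Word n → Series n} → (∀ c w → f c w ≋ g c w) →
    Ψ-block a u f ≋ Ψ-block a u g
  Ψ-block-cong a [] p v = Ψ-cong (p a []) v
  Ψ-block-cong a (b ∷ u) p v = cong₂ ℤ._-_
    (Ψ-block-cong b u (λ c w t → p a [] ((c ∷ w) ∷ t)) v)
    (Ψ-block-cong b u (λ c w t → p a (c ∷ w) t) v)

mutual
  Ψ-0 : (v : Monomial n) → Ψ (λ _ → pos 0) v ≡ pos 0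
  Ψ-0 [] = refl
  Ψ-0 ([] ∷ v) = Ψ-0 v
  Ψ-0 ((a ∷ u) ∷ v) = Ψ-block-0 a u v

  Ψ-block-0 : ∀ a u (v : Monomial n) → Ψ-block a u (λ _ _ _ → pos 0) v ≡ pos 0
  Ψ-block-0 a [] v = Ψ-0 v
  Ψ-block-0 a (b ∷ u) v = cong₂ ℤ._-_ (Ψ-block-0 b u v) (Ψ-block-0 b u v)

-‿linear : ∀ c x y x' y' →
  (c ℤ.* x ℤ.+ y) ℤ.- (c ℤ.* x' ℤ.+ y') ≡ c ℤ.* (x ℤ.- x') ℤ.+ (y ℤ.- y')
-‿linear = ℤ-Solver.solve-∀

mutual
  Ψ-linear : ∀ c (f g : Series n) v → Ψ (λ t → c ℤ.* f t ℤ.+ g t) v ≡ c ℤ.* Ψ f v ℤ.+ Ψ g v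
  Ψ-linear c f g [] = refl
  Ψ-linear c f g ([] ∷ v) = Ψ-linear c (f ∘ ([] ∷_)) (g ∘ ([] ∷_)) v
  Ψ-linear c f g ((a ∷ u) ∷ v) = Ψ-block-linear c a u _ _ v

  Ψ-block-linear : ∀ c a u (f g : Fin n → Word n → Series n) v →
    Ψ-block a u (λ d w t → c ℤ.* f d w t ℤ.+ g d w t) v
      ≡ c ℤ.* Ψ-block a u f v ℤ.+ Ψ-block a u g v
  Ψ-block-linear c a [] f g v = Ψ-linear c (f a []) (g a []) v
  Ψ-block-linear c a (b ∷ u) f g v = trans
    (cong₂ ℤ._-_
      (Ψ-block-linear c b u (λ d w t → f a [] ((d ∷ w) ∷ t)) (λ d w t → g a [] ((d ∷ w) ∷ t)) v)
      (Ψ-block-linear c b u (λ d w t → f a (d ∷ w) t) (λ d w t → g a (d ∷ w) t) v))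
    (-‿linear c _ _ _ _)

compatibleᶻ : Bool → MarkedWord n → Series n
compatibleᶻ b s v = pos (𝟙 (compatible b s v))

mutual
  Ψ-compatible : (s : MarkedWord n) → Ψ (compatibleᶻ false s) ≋ compatibleᶻ true s
  Ψ-compatible [] [] = refl
  Ψ-compatible (_ ∷ _) [] = refl
  Ψ-compatible s ([] ∷ v) = Ψ-compatible s v
  Ψ-compatible s ((a ∷ u) ∷ v) = Ψ-block-compatible s a u v

  -- Inside a block, a marked letter kills the unsplit term and leaves the split one. After an
  -- unmarked letter splitting is optional, so both terms agree and cancel, as they must when
  -- unmarked letters end blocks.
  Ψ-block-compatible : ∀ (s : MarkedWord n) a u v →
    Ψ-block a u (λ c w t → compatibleᶻ false s ((c ∷ w) ∷ t)) v ≡ compatibleᶻ true s ((a ∷ u) ∷ v)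
  Ψ-block-compatible [] a u v = Ψ-block-0 a u v
  Ψ-block-compatible ((c , k) ∷ s) a [] v with does (c ≟ᶠ a)
  ... | true = Ψ-compatible s v
  ... | false = Ψ-0 v
  Ψ-block-compatible ((c , k) ∷ s) a (b ∷ u) v with does (c ≟ᶠ a) | k
  ... | false | _ = Ψ-block-0 a (b ∷ u) v
  ... | true | true = trans
    (cong₂ ℤ._-_ (Ψ-block-compatible s b u v) (Ψ-block-0 b u v)) (ℤₚ.+-identityʳ _)
  ... | true | false = ℤₚ.+-inverseʳ (Ψ-block b u (λ c w t → compatibleᶻ false s ((c ∷ w) ∷ t)) v)

evalF-ψ : (cs : LinComb n) → evalF (ψ cs) ≋ Ψ (evalF cs)
evalF-ψ [] v = sym (Ψ-0 v)
evalF-ψ ((c , I) ∷ cs) v = begin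
  c ℤ.* F (complement I) v ℤ.+ evalF (ψ cs) v
    ≡⟨ cong₂ (λ x y → c ℤ.* x ℤ.+ y) (F-complement I v) (evalF-ψ cs v) ⟩
  c ℤ.* compatibleᶻ true (toMarked I) v ℤ.+ Ψ (evalF cs) v
    ≡⟨ cong (λ x → c ℤ.* x ℤ.+ Ψ (evalF cs) v) (Ψ-compatible (toMarked I) v) ⟨
  c ℤ.* Ψ (compatibleᶻ false (toMarked I)) v ℤ.+ Ψ (evalF cs) v
    ≡⟨ cong (λ x → c ℤ.* x ℤ.+ Ψ (evalF cs) v) (Ψ-cong (F-compatible I) v) ⟨
  c ℤ.* Ψ (F I) v ℤ.+ Ψ (evalF cs) v
    ≡⟨ Ψ-linear c (F I) (evalF cs) v ⟨
  Ψ (evalF ((c , I) ∷ cs)) v ∎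

-- Shuffles and products

-- These identities bring a sum into the form that `∑-extend-inside` takes once its coefficients are
-- known to be 0 or 1.
1*[1*x+0] : ∀ x → x ≡ 1 * (1 * x + 0)
1*[1*x+0] = solve-∀

1*[0+1*x] : ∀ x → x ≡ 1 * (0 + 1 * x)
1*[0+1*x] = solve-∀

1*[1*x+1*y] : ∀ x y → x + y ≡ 1 * (1 * x + 1 * y)
1*[1*x+1*y] = solve-∀

-- Shuffles of a top row w with the marked word s of the rows below; the name tells where the
-- first letter comes from.  Going from the top row to a lower one is a descent, coming back is not.
mutual
  shuffleTop : Word n → MarkedWord n → List (MarkedWord n)
  shuffleTop [] s = []
  shuffleTop (a ∷ w) s =
    map ((a , false) ∷_) (shuffleTop w s) ++ map ((a , true) ∷_) (shuffleBelow w s)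

  shuffleBelow : Word n → MarkedWord n → List (MarkedWord n)
  shuffleBelow w ((c , k) ∷ s) =
    map ((c , false) ∷_) (shuffleTop w s) ++ map ((c , k) ∷_) (shuffleBelow w s)
  -- The empty shuffle is counted here and not in `shuffleTop`, so the two lists together contain
  -- each shuffle once.
  shuffleBelow [] [] = [] ∷ []
  shuffleBelow (_ ∷ _) [] = []

standardTableaux : Sentence n → List (MarkedWord n)
standardTableaux [] = [] ∷ []
standardTableaux (w ∷ J) = concatMap (shuffleTop (toList w)) (standardTableaux J)

splitSum : Word n → (Word n → Word n → ℕ) → ℕ
splitSum [] g = g [] []
splitSum (a ∷ u) g = g [] (a ∷ u) + splitSum u (λ x y → g (a ∷ x) y)

-- `p` comes from the top row and `q` from the rows below: the type of a CIT reads rows from the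
-- bottom up, that of a CRSIT from the top down.
merge : Bool → Word n → Word n → Word n
merge false p q = q ++ p
merge true p q = p ++ q

blockSum : Bool → Word n → (Word n → Word n → ℕ) → ℕ
blockSum false u g = splitSum u (λ x y → g y x)
blockSum true u g = splitSum u g

-- Sum over the pairs (p , q) of monomials merging, block by block, to the given one.
mergeSum : Bool → Monomial n → (Monomial n → Monomial n → ℕ) → ℕ
mergeSum b [] g = g [] []
mergeSum b (u ∷ v) g = blockSum b u (λ x y → mergeSum b v (λ p q → g (x ∷ p) (y ∷ q)))

splitSum-cong : (u : Word n) {f g : Word n → Word n → ℕ} →
  (∀ x y → f x y ≡ g x y) → splitSum u f ≡ splitSum u g
splitSum-cong [] p = p [] []
splitSum-cong (a ∷ u) p = cong₂ _+_ (p [] (a ∷ u)) (splitSum-cong u (λ x y → p (a ∷ x) y))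

blockSum-cong : ∀ b (u : Word n) {f g : Word n → Word n → ℕ} →
  (∀ x y → f x y ≡ g x y) → blockSum b u f ≡ blockSum b u g
blockSum-cong false u p = splitSum-cong u (λ x y → p y x)
blockSum-cong true u p = splitSum-cong u p

-- The lengths are supplied because rows and fillings are enumerated up to the number of blocks,
-- which `p` and `q` share with `v`.
mergeSum-cong : ∀ b (v : Monomial n) {f g : Monomial n → Monomial n → ℕ} →
  (∀ p q → length p ≡ length v → length q ≡ length v → f p q ≡ g p q) →
  mergeSum b v f ≡ mergeSum b v g
mergeSum-cong b [] e = e [] [] refl refl
mergeSum-cong b (u ∷ v) e = blockSum-cong b u (λ x y → mergeSum-cong b v (λ p q lp lq →
  e (x ∷ p) (y ∷ q) (cong suc lp) (cong suc lq)))

mergeSum-ext : ∀ b (v : Monomial n) {f g : Monomial n → Monomial n → ℕ} →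
  (∀ p q → f p q ≡ g p q) → mergeSum b v f ≡ mergeSum b v g
mergeSum-ext b v e = mergeSum-cong b v (λ p q _ _ → e p q)

splitSum-+ : (u : Word n) (f g : Word n → Word n → ℕ) →
  splitSum u (λ x y → f x y + g x y) ≡ splitSum u f + splitSum u g
splitSum-+ [] f g = refl
splitSum-+ (a ∷ u) f g = trans
  (cong (f [] (a ∷ u) + g [] (a ∷ u) +_) (splitSum-+ u (f ∘ (a ∷_)) (g ∘ (a ∷_))))
  (interchange (f [] (a ∷ u)) (g [] (a ∷ u)) _ _)

blockSum-+ : ∀ b (u : Word n) (f g : Word n → Word n → ℕ) →
  blockSum b u (λ x y → f x y + g x y) ≡ blockSum b u f + blockSum b u g
blockSum-+ false u f g = splitSum-+ u (λ x y → f y x) (λ x y → g y x)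
blockSum-+ true u f g = splitSum-+ u f g

mergeSum-+ : ∀ b (v : Monomial n) (f g : Monomial n → Monomial n → ℕ) →
  mergeSum b v (λ p q → f p q + g p q) ≡ mergeSum b v f + mergeSum b v g
mergeSum-+ b [] f g = refl
mergeSum-+ b (u ∷ v) f g = trans
  (blockSum-cong b u (λ x y → mergeSum-+ b v (λ p q → f (x ∷ p) (y ∷ q)) (λ p q → g (x ∷ p) (y ∷ q))))
  (blockSum-+ b u _ _)

splitSum-0 : (u : Word n) → splitSum u (λ _ _ → 0) ≡ 0
splitSum-0 [] = refl
splitSum-0 (a ∷ u) = splitSum-0 u

blockSum-0 : ∀ b (u : Word n) → blockSum b u (λ _ _ → 0) ≡ 0
blockSum-0 false = splitSum-0
blockSum-0 true = splitSum-0

mergeSum-0 : ∀ b (v : Monomial n) → mergeSum b v (λ _ _ → 0) ≡ 0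
mergeSum-0 b [] = refl
mergeSum-0 b (u ∷ v) = trans (blockSum-cong b u (λ _ _ → mergeSum-0 b v)) (blockSum-0 b u)

mergeSum-∑ : ∀ b (v : Monomial n) (xs : List X) (f : X → Monomial n → Monomial n → ℕ) →
  mergeSum b v (λ p q → ∑ xs (λ x → f x p q)) ≡ ∑ xs (λ x → mergeSum b v (f x))
mergeSum-∑ b v [] f = mergeSum-0 b v
mergeSum-∑ b v (x ∷ xs) f = trans
  (mergeSum-+ b v (f x) (λ p q → ∑ xs (λ x → f x p q)))
  (cong (mergeSum b v (f x) +_) (mergeSum-∑ b v xs f))

-- A single row has no descents.
unmarked : Word n → MarkedWord n
unmarked = map (_, false)

-- Here p records the top row and q the rows below it.  The first column increases at its top iff
-- no letter of q lies in a block before the first nonempty block of p nor, when b = false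
-- (strict increase), in that block.
topFirst : Bool → Monomial n → Monomial n → Bool
topFirst b ((_ ∷ _) ∷ p) ([] ∷ q) = true
topFirst b ((_ ∷ _) ∷ p) ((_ ∷ _) ∷ q) = b
topFirst b ([] ∷ p) ([] ∷ q) = topFirst b p q
topFirst b ([] ∷ p) ((_ ∷ _) ∷ q) = false
topFirst b _ _ = true

compat : Bool → MarkedWord n → Monomial n → ℕ
compat b s v = 𝟙 (compatible b s v)

∑-∧ : ∀ d (f : X → Bool) xs → ∑ xs (λ x → 𝟙 (d ∧ f x)) ≡ 𝟙 d * ∑ xs (𝟙 ∘ f)
∑-∧ true f xs = sym (*-identityˡ _)
∑-∧ false f xs = ∑-zero xs

-- The letter closes its block, so both marks are admissible.
∑-extend : ∀ b c k k' (S S' : List (MarkedWord n)) a v →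
  ∑ (map ((c , k) ∷_) S ++ map ((c , k') ∷_) S') (λ s → compat b s ((a ∷ []) ∷ v))
    ≡ 𝟙 (does (c ≟ᶠ a)) * (∑ S (λ s → compat b s v) + ∑ S' (λ s → compat b s v))
∑-extend {n} b c k k' S S' a v = begin
  ∑ (map ((c , k) ∷_) S ++ map ((c , k') ∷_) S') f
    ≡⟨ ∑-++ f (map ((c , k) ∷_) S) _ ⟩
  ∑ (map ((c , k) ∷_) S) f + ∑ (map ((c , k') ∷_) S') f
    ≡⟨ cong₂ _+_ (extend k S) (extend k' S') ⟩
  𝟙 d * ∑ S g + 𝟙 d * ∑ S' g
    ≡⟨ *-distribˡ-+ (𝟙 d) (∑ S g) (∑ S' g) ⟨
  𝟙 d * (∑ S g + ∑ S' g) ∎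
  where
  d = does (c ≟ᶠ a)
  f = λ s → compat b s ((a ∷ []) ∷ v)
  g = λ s → compat b s v
  extend : ∀ k S → ∑ (map ((c , k) ∷_) S) f ≡ 𝟙 d * ∑ S g
  extend k S = trans (∑-map _ f S) (∑-∧ d (λ s → compatible b s v) S)

-- The block goes on after the letter, so each list contributes only if its mark agrees with `b`.
∑-extend-inside : ∀ b c k k' (S S' : List (MarkedWord n)) a a' u v →
  ∑ (map ((c , k) ∷_) S ++ map ((c , k') ∷_) S') (λ s → compat b s ((a ∷ a' ∷ u) ∷ v))
    ≡ 𝟙 (does (c ≟ᶠ a)) * (𝟙 (agrees k b) * ∑ S (λ s → compat b s ((a' ∷ u) ∷ v))
                          + 𝟙 (agrees k' b) * ∑ S' (λ s → compat b s ((a' ∷ u) ∷ v)))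
∑-extend-inside {n} b c k k' S S' a a' u v = begin
  ∑ (map ((c , k) ∷_) S ++ map ((c , k') ∷_) S') f
    ≡⟨ ∑-++ f (map ((c , k) ∷_) S) _ ⟩
  ∑ (map ((c , k) ∷_) S) f + ∑ (map ((c , k') ∷_) S') f
    ≡⟨ cong₂ _+_ (extend k S) (extend k' S') ⟩
  𝟙 d * (𝟙 (agrees k b) * ∑ S g) + 𝟙 d * (𝟙 (agrees k' b) * ∑ S' g)
    ≡⟨ *-distribˡ-+ (𝟙 d) _ _ ⟨
  𝟙 d * (𝟙 (agrees k b) * ∑ S g + 𝟙 (agrees k' b) * ∑ S' g) ∎
  where
  d = does (c ≟ᶠ a)
  f = λ s → compat b s ((a ∷ a' ∷ u) ∷ v)
  g = λ s → compat b s ((a' ∷ u) ∷ v)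
  extend : ∀ k S → ∑ (map ((c , k) ∷_) S) f ≡ 𝟙 d * (𝟙 (agrees k b) * ∑ S g)
  extend k S = trans (∑-map _ f S) (trans (∑-∧ d _ S)
    (cong (𝟙 d *_) (∑-∧ (agrees k b) (λ s → compatible b s ((a' ∷ u) ∷ v)) S)))

mergeSum-*0 : ∀ b (v : Monomial n) (f : Monomial n → Monomial n → ℕ) →
  mergeSum b v (λ p q → f p q * 0) ≡ 0
mergeSum-*0 b v f = trans (mergeSum-ext b v (λ p q → *-zeroʳ (f p q))) (mergeSum-0 b v)

splitSum-mergeSum-0 : ∀ b (u : Word n) (v : Monomial n) → splitSum u (λ _ _ → mergeSum b v (λ _ _ → 0)) ≡ 0
splitSum-mergeSum-0 b u v = trans (splitSum-cong u (λ _ _ → mergeSum-0 b v)) (splitSum-0 u)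

splitSum-mergeSum-*0 : ∀ b (u : Word n) (v : Monomial n) (f : Word n → Word n → Monomial n → Monomial n → ℕ) →
  splitSum u (λ x y → mergeSum b v (λ p q → f x y p q * 0)) ≡ 0
splitSum-mergeSum-*0 b u v f =
  trans (splitSum-cong u (λ x y → mergeSum-*0 b v (f x y))) (splitSum-0 u)

∑-shuffles : Bool → Word n → MarkedWord n → Monomial n → ℕ
∑-shuffles b w s v =
  ∑ (shuffleTop w s) (λ t → compat b t v) + ∑ (shuffleBelow w s) (λ t → compat b t v)

product : Bool → Word n → MarkedWord n → Monomial n → Monomial n → ℕ
product b w s p q = compat b (unmarked w) p * compat b s q

∑-shuffleBelow-[] : ∀ b (w : Word n) a u v →
  ∑ (shuffleBelow w []) (λ t → compat b t ((a ∷ u) ∷ v)) ≡ 0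
∑-shuffleBelow-[] b [] a u v = refl
∑-shuffleBelow-[] b (_ ∷ _) a u v = refl

product-shuffles-[] : ∀ b (w : Word n) s → product b w s [] [] ≡ ∑-shuffles b w s []
product-shuffles-[] {n} b w s = trans (ends w s) (sym (cong₂ _+_ (top w s) (below w s)))
  where
  end : Word n → MarkedWord n → ℕ
  end [] [] = 1
  end _ _ = 0
  ends : ∀ w s → product b w s [] [] ≡ end w s
  ends [] [] = refl
  ends [] (_ ∷ _) = refl
  ends (_ ∷ _) _ = refl
  dies : ∀ x S → ∑ (map (x ∷_) S) (λ t → compat b t []) ≡ 0
  dies x S = trans (∑-map _ _ S) (∑-zero S)
  dies₂ : ∀ x y S S' → ∑ (map (x ∷_) S ++ map (y ∷_) S') (λ t → compat b t []) ≡ 0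
  dies₂ x y S S' =
    trans (∑-++ _ (map (x ∷_) S) _) (cong₂ _+_ (dies x S) (dies y S'))
  top : ∀ w s → ∑ (shuffleTop w s) (λ t → compat b t []) ≡ 0
  top [] s = refl
  top (a ∷ w) s = dies₂ _ _ (shuffleTop w s) (shuffleBelow w s)
  below : ∀ w s → ∑ (shuffleBelow w s) (λ t → compat b t []) ≡ end w s
  below [] [] = refl
  below (_ ∷ _) [] = refl
  below [] ((c , k) ∷ s) = dies₂ (c , false) (c , k) [] (shuffleBelow [] s)
  below w@(_ ∷ _) (x ∷ s) = dies₂ _ _ (shuffleTop w s) (shuffleBelow w s)

-- In a block the rows below precede the top row.
mutual
  weak-product : ∀ (w : Word n) s v → mergeSum false v (product false w s) ≡ ∑-shuffles false w s v
  weak-product w s [] = product-shuffles-[] false w s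
  weak-product w s ([] ∷ v) = weak-product w s v
  weak-product w s ((a ∷ u) ∷ v) = cong₂ _+_ (weak-top w s a u v) (weak-below w s a u v)

  -- After a letter of the top row the whole block is in the top row, so nothing is left to split.
  -- On the shuffle side, going down inside the block is a forbidden descent.
  weak-top : ∀ (w : Word n) s a u v →
    mergeSum false v (λ p q → product false w s ((a ∷ u) ∷ p) q)
      ≡ ∑ (shuffleTop w s) (λ t → compat false t ((a ∷ u) ∷ v))
  weak-top [] s a u v = mergeSum-0 false v
  weak-top {n} (c ∷ w) s a [] v =
    trans step (sym (∑-extend false c false true (shuffleTop w s) (shuffleBelow w s) a v))
    where
    step : mergeSum false v (λ p q → product false (c ∷ w) s ((a ∷ []) ∷ p) q)
      ≡ 𝟙 (does (c ≟ᶠ a)) * ∑-shuffles false w s v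
    step with does (c ≟ᶠ a)
    ... | true = trans (weak-product w s v) (sym (*-identityˡ _))
    ... | false = mergeSum-0 false v
  weak-top {n} (c ∷ w) s a (a' ∷ u) v =
    trans step (sym (∑-extend-inside false c false true (shuffleTop w s) (shuffleBelow w s) a a' u v))
    where
    top below : ℕ
    top = ∑ (shuffleTop w s) (λ t → compat false t ((a' ∷ u) ∷ v))
    below = ∑ (shuffleBelow w s) (λ t → compat false t ((a' ∷ u) ∷ v))
    step : mergeSum false v (λ p q → product false (c ∷ w) s ((a ∷ a' ∷ u) ∷ p) q)
      ≡ 𝟙 (does (c ≟ᶠ a)) * (1 * top + 0 * below)
    step with does (c ≟ᶠ a)
    ... | true = trans (weak-top w s a' u v) (1*[1*x+0] top)
    ... | false = mergeSum-0 false v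

  -- The next letter of the block may come from the top row, since going up is no descent, or from
  -- below if the mark in `s` permits. These are the first and the remaining terms of `splitSum`.
  weak-below : ∀ (w : Word n) s a u v →
    splitSum u (λ x y → mergeSum false v (λ p q → product false w s (y ∷ p) ((a ∷ x) ∷ q)))
      ≡ ∑ (shuffleBelow w s) (λ t → compat false t ((a ∷ u) ∷ v))
  weak-below w [] a u v = trans
    (splitSum-mergeSum-*0 false u v (λ x y p q → compat false (unmarked w) (y ∷ p)))
    (sym (∑-shuffleBelow-[] false w a u v))
  weak-below {n} w ((c , k) ∷ s) a [] v =
    trans step (sym (∑-extend false c false k (shuffleTop w s) (shuffleBelow w s) a v))
    where
    step : mergeSum false v (λ p q → product false w ((c , k) ∷ s) p ((a ∷ []) ∷ q))
      ≡ 𝟙 (does (c ≟ᶠ a)) * ∑-shuffles false w s v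
    step with does (c ≟ᶠ a)
    ... | true = trans (weak-product w s v) (sym (*-identityˡ _))
    ... | false = mergeSum-*0 false v (λ p q → compat false (unmarked w) p)
  weak-below {n} w ((c , k) ∷ s) a (a' ∷ u) v =
    trans step (sym (∑-extend-inside false c false k (shuffleTop w s) (shuffleBelow w s) a a' u v))
    where
    top below : ℕ
    top = ∑ (shuffleTop w s) (λ t → compat false t ((a' ∷ u) ∷ v))
    below = ∑ (shuffleBelow w s) (λ t → compat false t ((a' ∷ u) ∷ v))
    step : mergeSum false v (λ p q → product false w ((c , k) ∷ s) ((a' ∷ u) ∷ p) ((a ∷ []) ∷ q))
      + splitSum u (λ x y → mergeSum false v
          (λ p q → product false w ((c , k) ∷ s) (y ∷ p) ((a ∷ a' ∷ x) ∷ q)))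
      ≡ 𝟙 (does (c ≟ᶠ a)) * (1 * top + 𝟙 (agrees k false) * below)
    step with does (c ≟ᶠ a) | agrees k false
    ... | true | true = trans
      (cong₂ _+_ (weak-top w s a' u v) (weak-below w s a' u v)) (1*[1*x+1*y] top below)
    ... | true | false = trans
      (cong₂ _+_ (weak-top w s a' u v)
        (splitSum-mergeSum-*0 false u v (λ x y p q → compat false (unmarked w) (y ∷ p))))
      (trans (+-identityʳ top) (1*[1*x+0] top))
    ... | false | _ = cong₂ _+_
      (mergeSum-*0 false v (λ p q → compat false (unmarked w) ((a' ∷ u) ∷ p)))
      (splitSum-mergeSum-*0 false u v (λ x y p q → compat false (unmarked w) (y ∷ p)))

-- In a block the top row comes first, with at most one letter.
mutual
  strict-product : ∀ (w : Word n) s v → mergeSum true v (product true w s) ≡ ∑-shuffles true w s v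
  strict-product w s [] = product-shuffles-[] true w s
  strict-product w s ([] ∷ v) = strict-product w s v
  strict-product w s ((a ∷ u) ∷ v) = trans
    (cong₂ _+_ (strict-below w s a u v) (strict-top w s a u v))
    (+-comm (∑ (shuffleBelow w s) _) (∑ (shuffleTop w s) _))

  -- A second letter of the top row would follow an unmarked one and is forbidden, so any
  -- continuation of the block goes down, which is the required descent.
  strict-top : ∀ (w : Word n) s a u v →
    splitSum u (λ x y → mergeSum true v (λ p q → product true w s ((a ∷ x) ∷ p) (y ∷ q)))
      ≡ ∑ (shuffleTop w s) (λ t → compat true t ((a ∷ u) ∷ v))
  strict-top [] s a u v = splitSum-mergeSum-0 true u v
  strict-top {n} (c ∷ w) s a [] v =
    trans step (sym (∑-extend true c false true (shuffleTop w s) (shuffleBelow w s) a v))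
    where
    step : mergeSum true v (λ p q → product true (c ∷ w) s ((a ∷ []) ∷ p) q)
      ≡ 𝟙 (does (c ≟ᶠ a)) * ∑-shuffles true w s v
    step with does (c ≟ᶠ a)
    ... | true = trans (strict-product w s v) (sym (*-identityˡ _))
    ... | false = mergeSum-0 true v
  strict-top {n} (c ∷ w) s a (a' ∷ u) v =
    trans step (sym (∑-extend-inside true c false true (shuffleTop w s) (shuffleBelow w s) a a' u v))
    where
    top below : ℕ
    top = ∑ (shuffleTop w s) (λ t → compat true t ((a' ∷ u) ∷ v))
    below = ∑ (shuffleBelow w s) (λ t → compat true t ((a' ∷ u) ∷ v))
    step : mergeSum true v (λ p q → product true (c ∷ w) s ((a ∷ []) ∷ p) ((a' ∷ u) ∷ q))
      + splitSum u (λ x y → mergeSum true v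
          (λ p q → product true (c ∷ w) s ((a ∷ a' ∷ x) ∷ p) (y ∷ q)))
      ≡ 𝟙 (does (c ≟ᶠ a)) * (0 * top + 1 * below)
    step with does (c ≟ᶠ a)
    ... | true = trans
      (cong₂ _+_ (strict-below w s a' u v) (splitSum-mergeSum-0 true u v))
      (trans (+-identityʳ below) (1*[0+1*x] below))
    ... | false = cong₂ _+_ (mergeSum-0 true v) (splitSum-mergeSum-0 true u v)

  -- The block stays below, since returning to the top row is not a descent; moves among the lower
  -- rows keep their marks from `s`.
  strict-below : ∀ (w : Word n) s a u v →
    mergeSum true v (λ p q → product true w s p ((a ∷ u) ∷ q))
      ≡ ∑ (shuffleBelow w s) (λ t → compat true t ((a ∷ u) ∷ v))
  strict-below w [] a u v = trans
    (mergeSum-*0 true v (λ p q → compat true (unmarked w) p))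
    (sym (∑-shuffleBelow-[] true w a u v))
  strict-below {n} w ((c , k) ∷ s) a [] v =
    trans step (sym (∑-extend true c false k (shuffleTop w s) (shuffleBelow w s) a v))
    where
    step : mergeSum true v (λ p q → product true w ((c , k) ∷ s) p ((a ∷ []) ∷ q))
      ≡ 𝟙 (does (c ≟ᶠ a)) * ∑-shuffles true w s v
    step with does (c ≟ᶠ a)
    ... | true = trans (strict-product w s v) (sym (*-identityˡ _))
    ... | false = mergeSum-*0 true v (λ p q → compat true (unmarked w) p)
  strict-below {n} w ((c , k) ∷ s) a (a' ∷ u) v =
    trans step (sym (∑-extend-inside true c false k (shuffleTop w s) (shuffleBelow w s) a a' u v))
    where
    top below : ℕ
    top = ∑ (shuffleTop w s) (λ t → compat true t ((a' ∷ u) ∷ v))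
    below = ∑ (shuffleBelow w s) (λ t → compat true t ((a' ∷ u) ∷ v))
    step : mergeSum true v (λ p q → product true w ((c , k) ∷ s) p ((a ∷ a' ∷ u) ∷ q))
      ≡ 𝟙 (does (c ≟ᶠ a)) * (0 * top + 𝟙 (agrees k true) * below)
    step with does (c ≟ᶠ a) | agrees k true
    ... | true | true = trans (strict-below w s a' u v) (1*[0+1*x] below)
    ... | true | false = mergeSum-*0 true v (λ p q → compat true (unmarked w) p)
    ... | false | _ = mergeSum-*0 true v (λ p q → compat true (unmarked w) p)

-- In the order in which blocks are merged, `topFirst` says that the first letter of the monomial
-- lies in the top row, so of all shuffles only those in `shuffleTop` remain.
topFirst-product : ∀ b (w : List⁺ (Fin n)) s v →
  mergeSum b v (λ p q → 𝟙 (topFirst b p q) * product b (toList w) s p q)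
    ≡ ∑ (shuffleTop (toList w) s) (λ t → compat b t v)
topFirst-product b (a ∷ w) s [] = sym (trans
  (∑-++ _ (map _ (shuffleTop w s)) _)
  (cong₂ _+_ (trans (∑-map _ _ (shuffleTop w s)) (∑-zero (shuffleTop w s)))
             (trans (∑-map _ _ (shuffleBelow w s)) (∑-zero (shuffleBelow w s)))))
topFirst-product false w s ([] ∷ v) = topFirst-product false w s v
topFirst-product true w s ([] ∷ v) = topFirst-product true w s v
topFirst-product false w s ((a ∷ u) ∷ v) = trans
  (cong₂ _+_
    (mergeSum-ext false v (λ p q → *-identityˡ (product false (toList w) s ((a ∷ u) ∷ p) q)))
    (trans (splitSum-cong u (λ x y → trans (mergeSum-ext false v (vanish x y)) (mergeSum-0 false v)))
           (splitSum-0 u)))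
  (trans (+-identityʳ _) (weak-top (toList w) s a u v))
  where
  vanish : ∀ x y p q → 𝟙 (topFirst false (y ∷ p) ((a ∷ x) ∷ q))
    * product false (toList w) s (y ∷ p) ((a ∷ x) ∷ q) ≡ 0
  vanish x [] p q = refl
  vanish x (_ ∷ _) p q = refl
topFirst-product true w s ((a ∷ u) ∷ v) = trans
  (cong₂ _+_ (mergeSum-0 true v)
    (splitSum-cong u (λ x y → mergeSum-ext true v (keep x y))))
  (strict-top (toList w) s a u v)
  where
  keep : ∀ x y p q → 𝟙 (topFirst true ((a ∷ x) ∷ p) (y ∷ q))
    * product true (toList w) s ((a ∷ x) ∷ p) (y ∷ q) ≡ product true (toList w) s ((a ∷ x) ∷ p) (y ∷ q)
  keep x [] p q = *-identityˡ _
  keep x (_ ∷ _) p q = *-identityˡ _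

-- Single rows

-- The row order of a CIT for `false` and of a CRSIT for `true`; the first column obeys the order of
-- `not b`.
rel : Bool → ℕ → ℕ → Bool
rel false = _≤ᵇ_
rel true = _<ᵇ_

increasing : Bool → List ℕ → Bool
increasing false = weakIncr
increasing true = strictIncr

increasing-∷∷ : ∀ b x y ys → increasing b (x ∷ y ∷ ys) ≡ rel b x y ∧ increasing b (y ∷ ys)
increasing-∷∷ false x y ys = refl
increasing-∷∷ true x y ys = refl

increasing-[-] : ∀ b x → increasing b (x ∷ []) ≡ true
increasing-[-] false x = refl
increasing-[-] true x = refl

increasing-[] : ∀ b → increasing b [] ≡ true
increasing-[] false = refl
increasing-[] true = refl

rel-suc : ∀ b x y → rel b (suc x) (suc (suc y)) ≡ rel b x (suc y)
rel-suc false zero y = refl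
rel-suc false (suc x) y = refl
rel-suc true x y = refl

rel-suc-suc-1 : ∀ b x → rel b (suc (suc x)) 1 ≡ false
rel-suc-suc-1 false x = refl
rel-suc-suc-1 true x = refl

∑-applyUpTo : (h : ℕ → X) (m : ℕ) (f : X → ℕ) → ∑ (applyUpTo h m) f ≡ ∑ (upTo m) (f ∘ h)
∑-applyUpTo h m f = trans (cong (λ xs → ∑ xs f) (sym (map-upTo h m))) (∑-map h f (upTo m))

∑-rowsUpTo : ∀ l m (f : List ℕ → ℕ) →
  ∑ (rowsUpTo (suc l) m) f ≡ ∑ (upTo m) (λ e → ∑ (rowsUpTo l m) (λ r → f (suc e ∷ r)))
∑-rowsUpTo l m f = begin
  ∑ (rowsUpTo (suc l) m) f
    ≡⟨ ∑-concatMap (λ e → map (e ∷_) (rowsUpTo l m)) f (applyUpTo suc m) ⟩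
  ∑ (applyUpTo suc m) (λ e → ∑ (map (e ∷_) (rowsUpTo l m)) f)
    ≡⟨ ∑-applyUpTo suc m _ ⟩
  ∑ (upTo m) (λ e → ∑ (map (suc e ∷_) (rowsUpTo l m)) f)
    ≡⟨ ∑-ext (upTo m) (λ e → ∑-map (suc e ∷_) f (rowsUpTo l m)) ⟩
  ∑ (upTo m) (λ e → ∑ (rowsUpTo l m) (λ r → f (suc e ∷ r))) ∎

∑-rowsUpTo-suc : ∀ l m (f : List ℕ → ℕ) →
  ∑ (rowsUpTo (suc l) (suc m)) f
    ≡ ∑ (rowsUpTo l (suc m)) (λ r → f (1 ∷ r))
      + ∑ (upTo m) (λ e → ∑ (rowsUpTo l (suc m)) (λ r → f (suc (suc e) ∷ r)))
∑-rowsUpTo-suc l m f =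
  trans (∑-rowsUpTo l (suc m) f) (cong (∑ (rowsUpTo l (suc m)) (λ r → f (1 ∷ r)) +_) (∑-applyUpTo suc m _))

-- The hypothesis excludes the entry 1 after `suc e`, so all entries can be lowered by one.
∑-increasing-suc : ∀ b e l m (f : List ℕ → Bool) → rel b (suc e) 1 ≡ false →
  ∑ (rowsUpTo l (suc m)) (λ r → 𝟙 (increasing b (suc e ∷ r) ∧ f r))
    ≡ ∑ (rowsUpTo l m) (λ r → 𝟙 (increasing b (e ∷ r) ∧ f (map suc r)))
∑-increasing-suc b e zero m f e≰1 rewrite increasing-[-] b (suc e) | increasing-[-] b e = refl
∑-increasing-suc b e (suc l) m f e≰1 = begin
  ∑ (rowsUpTo (suc l) (suc m)) F₁
    ≡⟨ ∑-rowsUpTo-suc l m F₁ ⟩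
  ∑ (rowsUpTo l (suc m)) (λ r → F₁ (1 ∷ r))
    + ∑ (upTo m) (λ x → ∑ (rowsUpTo l (suc m)) (λ r → F₁ (suc (suc x) ∷ r)))
    ≡⟨ cong₂ _+_ (trans (∑-ext (rowsUpTo l (suc m)) ones) (∑-zero (rowsUpTo l (suc m))))
                 (∑-ext (upTo m) larger) ⟩
  ∑ (upTo m) (λ x → ∑ (rowsUpTo l m) (λ r → F₂ (suc x ∷ r)))
    ≡⟨ ∑-rowsUpTo l m F₂ ⟨
  ∑ (rowsUpTo (suc l) m) F₂ ∎
  where
  F₁ F₂ : List ℕ → ℕ
  F₁ r = 𝟙 (increasing b (suc e ∷ r) ∧ f r)
  F₂ r = 𝟙 (increasing b (e ∷ r) ∧ f (map suc r))
  ones : ∀ r → F₁ (1 ∷ r) ≡ 0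
  ones r rewrite increasing-∷∷ b (suc e) 1 r | e≰1 = refl
  larger : ∀ x → ∑ (rowsUpTo l (suc m)) (λ r → F₁ (suc (suc x) ∷ r))
    ≡ ∑ (rowsUpTo l m) (λ r → F₂ (suc x ∷ r))
  larger x = trans (∑-ext (rowsUpTo l (suc m)) (λ r → cong (λ y → 𝟙 (y ∧ f (suc (suc x) ∷ r)))
      (trans (increasing-∷∷ b (suc e) (suc (suc x)) r) (cong (_∧ _) (rel-suc b e x)))))
    (trans step (∑-ext (rowsUpTo l m) (λ r → cong (λ y → 𝟙 (y ∧ f (suc (suc x) ∷ map suc r)))
      (sym (increasing-∷∷ b e (suc x) r)))))
    where
    step : ∑ (rowsUpTo l (suc m))
          (λ r → 𝟙 ((rel b e (suc x) ∧ increasing b (suc (suc x) ∷ r)) ∧ f (suc (suc x) ∷ r)))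
      ≡ ∑ (rowsUpTo l m)
          (λ r → 𝟙 ((rel b e (suc x) ∧ increasing b (suc x ∷ r)) ∧ f (suc (suc x) ∷ map suc r)))
    step with rel b e (suc x)
    ... | true = ∑-increasing-suc b (suc x) l m (λ r → f (suc (suc x) ∷ r)) (rel-suc-suc-1 b x)
    ... | false = trans (∑-zero (rowsUpTo l (suc m))) (sym (∑-zero (rowsUpTo l m)))

-- An entry that can precede every row of positive entries without affecting whether it increases.
bottom : Bool → ℕ
bottom false = 1
bottom true = 0

∑-increasing-bottom : ∀ b l m (f : List ℕ → Bool) →
  ∑ (rowsUpTo l m) (λ r → 𝟙 (increasing b (bottom b ∷ r) ∧ f r))
    ≡ ∑ (rowsUpTo l m) (λ r → 𝟙 (increasing b r ∧ f r))
∑-increasing-bottom b zero m f rewrite increasing-[-] b (bottom b) | increasing-[] b = refl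
∑-increasing-bottom b (suc l) m f = trans (∑-rowsUpTo l m _) (trans
  (∑-ext (upTo m) (λ e → ∑-ext (rowsUpTo l m) (λ r → cong (λ y → 𝟙 (y ∧ f (suc e ∷ r))) (drop b e r))))
  (sym (∑-rowsUpTo l m _)))
  where
  drop : ∀ b e r → increasing b (bottom b ∷ suc e ∷ r) ≡ increasing b (suc e ∷ r)
  drop false e r = refl
  drop true e r = refl

-- Either the first entry is 1, or every entry exceeds 1 and the row is a shifted one.
∑-increasing : ∀ b l m (f : List ℕ → Bool) →
  ∑ (rowsUpTo (suc l) (suc m)) (λ r → 𝟙 (increasing b r ∧ f r))
    ≡ ∑ (rowsUpTo l (suc m)) (λ r → 𝟙 (increasing b (1 ∷ r) ∧ f (1 ∷ r)))
      + ∑ (rowsUpTo (suc l) m) (λ r → 𝟙 (increasing b r ∧ f (map suc r)))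
∑-increasing b l m f = trans (∑-rowsUpTo-suc l m _) (cong (∑ (rowsUpTo l (suc m)) _ +_)
  (trans (∑-ext (upTo m) (λ e →
           ∑-increasing-suc b (suc e) l m (λ r → f (suc (suc e) ∷ r)) (rel-suc-suc-1 b e)))
         (sym (∑-rowsUpTo l m _))))

Row : ℕ → ℕ → List ℕ → Set
Row l m r = length r ≡ l × All (λ x → 1 ≤ x × x ≤ m) r

rowsUpTo-Row : ∀ l m → All (Row l m) (rowsUpTo l m)
rowsUpTo-Row zero m = (refl , []) ∷ []
rowsUpTo-Row (suc l) m = concat⁺ (map⁺ (applyUpTo⁺₁ suc m (λ i<m → map⁺ (All.map
  (λ (len , bounds) → cong suc len , (s≤s z≤n , i<m) ∷ bounds) (rowsUpTo-Row l m)))))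

coloursInRow : ℕ → Word n → List ℕ → Word n
coloursInRow i (c ∷ w) (e ∷ r) = if e ≡ᵇ i then c ∷ coloursInRow i w r else coloursInRow i w r
coloursInRow i _ _ = []

rowType : ℕ → Word n → List ℕ → Monomial n
rowType m w r = applyUpTo (λ k → coloursInRow (suc k) w r) m

coloursInRow-suc : ∀ i (w : Word n) r → coloursInRow (suc i) w (map suc r) ≡ coloursInRow i w r
coloursInRow-suc i [] r = refl
coloursInRow-suc i (c ∷ w) [] = refl
coloursInRow-suc i (c ∷ w) (e ∷ r) with e ≡ᵇ i
... | true = cong (c ∷_) (coloursInRow-suc i w r)
... | false = coloursInRow-suc i w r

coloursInRow-1 : (w : Word n) {m : ℕ} {r : List ℕ} → All (λ x → 1 ≤ x × x ≤ m) r →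
  coloursInRow 1 w (map suc r) ≡ []
coloursInRow-1 [] _ = refl
coloursInRow-1 (c ∷ w) [] = refl
coloursInRow-1 (c ∷ w) ((s≤s _ , _) ∷ bounds) = coloursInRow-1 w bounds

applyUpTo-cong : {f g : ℕ → X} → (∀ k → f k ≡ g k) → ∀ m → applyUpTo f m ≡ applyUpTo g m
applyUpTo-cong p zero = refl
applyUpTo-cong p (suc m) = cong₂ _∷_ (p 0) (applyUpTo-cong (p ∘ suc) m)

rowType-suc : ∀ m (w : Word n) r →
  applyUpTo (λ k → coloursInRow (suc (suc k)) w (map suc r)) m ≡ rowType m w r
rowType-suc m w r = applyUpTo-cong (λ k → coloursInRow-suc (suc k) w r) m

empty-compat : ∀ b (p : Monomial n) → 𝟙 (applyUpTo (λ _ → []) (length p) ==ᵐ p) ≡ compat b [] p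
empty-compat b [] = refl
empty-compat b ([] ∷ p) = empty-compat b p
empty-compat b ((_ ∷ _) ∷ p) = refl

∑-∧false : (xs : List X) (f : X → Bool) → ∑ xs (λ x → 𝟙 (f x ∧ false)) ≡ 0
∑-∧false xs f = trans (∑-ext xs (λ x → cong 𝟙 (∧-comm (f x) false))) (∑-zero xs)

rowSum : Bool → ℕ → Word n → Monomial n → ℕ
rowSum b m w p = ∑ (rowsUpTo (length w) m) (λ r → 𝟙 (increasing b r ∧ (rowType m w r ==ᵐ p)))

RowsCompat : Bool → Word n → Monomial n → Set
RowsCompat b w p = rowSum b (length p) w p ≡ compat b (unmarked w) p

-- A leading 1 uses up the first letter of `u` and leaves the shorter word; a row without a 1 forces
-- `u` to be empty and leaves the shorter monomial.
rows-compat-step : ∀ b (c : Fin n) w u p →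
  (∀ p → RowsCompat b w p) → RowsCompat b (c ∷ w) p → RowsCompat b (c ∷ w) (u ∷ p)
rows-compat-step {n} b c w u p ihʷ ihᵖ =
  trans (∑-increasing b l m (λ r → rowType (suc m) (c ∷ w) r ==ᵐ (u ∷ p)))
        (trans (cong (firstIs1 u +_) (∑-cong (rowsUpTo (suc l) m)
                 (All.map (λ {r} → shifted u {r}) (rowsUpTo-Row (suc l) m))))
               (byFirstBlock u))
  where
  l = length w
  m = length p

  firstIs1 firstExceeds1 : Word n → ℕ
  firstIs1 u = ∑ (rowsUpTo l (suc m))
    (λ r → 𝟙 (increasing b (1 ∷ r) ∧ (rowType (suc m) (c ∷ w) (1 ∷ r) ==ᵐ (u ∷ p))))
  firstExceeds1 u = ∑ (rowsUpTo (suc l) m)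
    (λ r → 𝟙 (increasing b r ∧ (([] ==ʷ u) ∧ (rowType m (c ∷ w) r ==ᵐ p))))

  shifted : ∀ u {r} → Row (suc l) m r →
    𝟙 (increasing b r ∧ (rowType (suc m) (c ∷ w) (map suc r) ==ᵐ (u ∷ p)))
      ≡ 𝟙 (increasing b r ∧ (([] ==ʷ u) ∧ (rowType m (c ∷ w) r ==ᵐ p)))
  shifted u {r} (_ , bounds) = cong₂ (λ x y → 𝟙 (increasing b r ∧ ((x ==ʷ u) ∧ (y ==ᵐ p))))
    (coloursInRow-1 (c ∷ w) bounds) (rowType-suc m (c ∷ w) r)

  startsWith : ∀ b → (∀ p → RowsCompat b w p) → ∀ a u → ∑ (rowsUpTo l (suc m))
      (λ r → 𝟙 (increasing b (1 ∷ r) ∧ ((true ∧ (coloursInRow 1 w r ==ʷ u))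
        ∧ (applyUpTo (λ k → coloursInRow (suc (suc k)) w r) m ==ᵐ p))))
    ≡ compat b ((a , false) ∷ unmarked w) ((a ∷ u) ∷ p)
  -- A leading 1 does not restrict a weakly increasing row, so the remaining cells carry the rest of
  -- the block.
  startsWith false ih a u = trans (∑-increasing-bottom false l (suc m) _)
    (trans (ih (u ∷ p)) (sym (absorb u)))
    where
    absorb : ∀ u → compat false ((a , false) ∷ unmarked w) ((a ∷ u) ∷ p)
      ≡ compat false (unmarked w) (u ∷ p)
    absorb [] rewrite dec-true (a ≟ᶠ a) refl = refl
    absorb (_ ∷ _) rewrite dec-true (a ≟ᶠ a) refl = refl
  -- After a leading 1 a strict row continues from 2 on; lowered by one it is arbitrary, and `u`
  -- must be empty.
  startsWith true ih a u = trans (∑-increasing-suc true 0 l m _ refl)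
    (trans (∑-increasing-bottom true l m _)
    (trans (∑-cong (rowsUpTo l m) (All.map (λ {r} (_ , bounds) →
        cong₂ (λ x y → 𝟙 (strictIncr r ∧ ((x ==ʷ u) ∧ (y ==ᵐ p))))
          (coloursInRow-1 w bounds) (rowType-suc m w r))
        (rowsUpTo-Row l m)))
      (atMostOne u)))
    where
    atMostOne : ∀ u → ∑ (rowsUpTo l m) (λ r → 𝟙 (strictIncr r ∧ (([] ==ʷ u) ∧ (rowType m w r ==ᵐ p))))
      ≡ compat true ((a , false) ∷ unmarked w) ((a ∷ u) ∷ p)
    atMostOne [] rewrite dec-true (a ≟ᶠ a) refl = ih p
    atMostOne (_ ∷ _) rewrite dec-true (a ≟ᶠ a) refl = ∑-∧false (rowsUpTo l m) strictIncr

  byFirstBlock : ∀ u → firstIs1 u + firstExceeds1 u ≡ compat b (unmarked (c ∷ w)) (u ∷ p)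
  byFirstBlock [] = cong₂ _+_ (∑-∧false (rowsUpTo l (suc m)) (λ r → increasing b (1 ∷ r)))
    ihᵖ
  byFirstBlock (a ∷ u) = trans
    (cong (firstIs1 (a ∷ u) +_) (∑-∧false (rowsUpTo (suc l) m) (increasing b)))
    (trans (+-identityʳ _) (sameLetter (c ≟ᶠ a)))
    where
    clash : ∀ d u → d ≡ false → ∑ (rowsUpTo l (suc m))
        (λ r → 𝟙 (increasing b (1 ∷ r) ∧ ((d ∧ (coloursInRow 1 w r ==ʷ u))
          ∧ (applyUpTo (λ k → coloursInRow (suc (suc k)) w r) m ==ᵐ p)))) ≡ 0
    clash false u refl = ∑-∧false (rowsUpTo l (suc m)) (λ r → increasing b (1 ∷ r))
    sameLetter : Dec (c ≡ a) → firstIs1 (a ∷ u) ≡ compat b (unmarked (c ∷ w)) ((a ∷ u) ∷ p)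
    sameLetter (yes refl) = trans
      (∑-ext (rowsUpTo l (suc m)) (λ r → cong (λ d → 𝟙 (increasing b (1 ∷ r)
        ∧ ((d ∧ (coloursInRow 1 w r ==ʷ u))
          ∧ (applyUpTo (λ k → coloursInRow (suc (suc k)) w r) m ==ᵐ p)))) (dec-true (c ≟ᶠ c) refl)))
      (startsWith b ihʷ c u)
    sameLetter (no c≢a) = trans (clash (does (c ≟ᶠ a)) u (dec-false (c ≟ᶠ a) c≢a))
      (sym (mismatch u))
      where
      mismatch : ∀ u → compat b (unmarked (c ∷ w)) ((a ∷ u) ∷ p) ≡ 0
      mismatch [] rewrite dec-false (c ≟ᶠ a) c≢a = refl
      mismatch (_ ∷ _) rewrite dec-false (c ≟ᶠ a) c≢a = refl

-- A one-row shape has a single standard tableau, the word itself.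
rows-compat : ∀ b (w : Word n) p → RowsCompat b w p
rows-compat b [] p rewrite increasing-[] b = trans (+-identityʳ _) (empty-compat b p)
rows-compat b (c ∷ w) [] = refl
rows-compat b (c ∷ w) (u ∷ p) =
  rows-compat-step b c w u p (rows-compat b w) (rows-compat b (c ∷ w) p)

-- Tableaux

module _ where
  open Equivalence

  ∧-intro : ∀ x {y} → T x → T y → T (x ∧ y)
  ∧-intro x p q = from (T-∧ {x}) (p , q)

  ∧-elim : ∀ x {y} → T (x ∧ y) → T x × T y
  ∧-elim x = to (T-∧ {x})

T-ext : ∀ {x y} → (T x → T y) → (T y → T x) → x ≡ y
T-ext {true} {true} p q = refl
T-ext {true} {false} p q = ⊥-elim (p tt)
T-ext {false} {true} p q = ⊥-elim (q tt)
T-ext {false} {false} p q = refl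

-- Recovering a pair of types from their merge

splitSum-unique : ∀ (p q u : Word n) R →
  splitSum u (λ x y → 𝟙 ((p ==ʷ x) ∧ (q ==ʷ y)) * R) ≡ 𝟙 (p ++ q ==ʷ u) * R
splitSum-unique [] q [] R = refl
splitSum-unique (_ ∷ _) q [] R = refl
splitSum-unique [] q (a ∷ u) R =
  trans (cong (𝟙 (q ==ʷ (a ∷ u)) * R +_) (splitSum-0 u)) (+-identityʳ _)
splitSum-unique (c ∷ p) q (a ∷ u) R with does (c ≟ᶠ a)
... | true = splitSum-unique p q u R
... | false = splitSum-0 u

blockSum-unique : ∀ b (p q u : Word n) R →
  blockSum b u (λ x y → 𝟙 ((p ==ʷ x) ∧ (q ==ʷ y)) * R) ≡ 𝟙 (merge b p q ==ʷ u) * R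
blockSum-unique true p q u R = splitSum-unique p q u R
blockSum-unique false p q u R = trans
  (splitSum-cong u (λ x y → cong (λ d → 𝟙 d * R) (∧-comm (p ==ʷ y) (q ==ʷ x))))
  (splitSum-unique q p u R)

mergeSum-𝟙 : ∀ b (v : Monomial n) d (f : Monomial n → Monomial n → ℕ) →
  mergeSum b v (λ p q → 𝟙 d * f p q) ≡ 𝟙 d * mergeSum b v f
mergeSum-𝟙 b v true f =
  trans (mergeSum-ext b v (λ p q → *-identityˡ (f p q))) (sym (*-identityˡ _))
mergeSum-𝟙 b v false f = mergeSum-0 b v

𝟙-interchange : ∀ x y z w → 𝟙 (x ∧ y) * 𝟙 (z ∧ w) ≡ 𝟙 (x ∧ z) * (𝟙 y * 𝟙 w)
𝟙-interchange true y true w = sym (*-identityˡ _)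
𝟙-interchange true y false w = *-zeroʳ (𝟙 y)
𝟙-interchange false y z w = refl

-- This turns a condition on the merged type into a sum over pairs of types, in which the two
-- factors separate.
mergeSum-unique : ∀ b (v : Monomial n) (f g : ℕ → Word n) →
  mergeSum b v (λ p q → 𝟙 (applyUpTo f (length v) ==ᵐ p) * 𝟙 (applyUpTo g (length v) ==ᵐ q))
    ≡ 𝟙 (applyUpTo (λ k → merge b (f k) (g k)) (length v) ==ᵐ v)
mergeSum-unique b [] f g = refl
mergeSum-unique {n} b (u ∷ v) f g = begin
  blockSum b u (λ x y → mergeSum b v (λ p q →
      𝟙 ((f 0 ==ʷ x) ∧ (P ==ᵐ p)) * 𝟙 ((g 0 ==ʷ y) ∧ (Q ==ᵐ q))))
    ≡⟨ blockSum-cong b u (λ x y → trans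
        (mergeSum-ext b v (λ p q → 𝟙-interchange (f 0 ==ʷ x) (P ==ᵐ p) (g 0 ==ʷ y) (Q ==ᵐ q)))
        (trans (mergeSum-𝟙 b v ((f 0 ==ʷ x) ∧ (g 0 ==ʷ y)) _)
               (cong (𝟙 ((f 0 ==ʷ x) ∧ (g 0 ==ʷ y)) *_)
                     (mergeSum-unique b v (f ∘ suc) (g ∘ suc))))) ⟩
  blockSum b u (λ x y → 𝟙 ((f 0 ==ʷ x) ∧ (g 0 ==ʷ y)) * 𝟙 (R ==ᵐ v))
    ≡⟨ blockSum-unique b (f 0) (g 0) u _ ⟩
  𝟙 (merge b (f 0) (g 0) ==ʷ u) * 𝟙 (R ==ᵐ v)
    ≡⟨ 𝟙-∧ (merge b (f 0) (g 0) ==ʷ u) (R ==ᵐ v) ⟨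
  𝟙 ((merge b (f 0) (g 0) ==ʷ u) ∧ (R ==ᵐ v)) ∎
  where
  P Q R : Monomial n
  P = applyUpTo (f ∘ suc) (length v)
  Q = applyUpTo (g ∘ suc) (length v)
  R = applyUpTo (λ k → merge b (f (suc k)) (g (suc k))) (length v)

==ᵐ⇒≡ : (u v : Monomial n) → (u ==ᵐ v) ≡ true → u ≡ v
==ᵐ⇒≡ u v p with ≡-dec (≡-dec _≟ᶠ_) u v
... | yes u≡v = u≡v

-- Only the term with `p` and `q` equal to the actual types survives, so `topFirst` may be evaluated
-- at the summation variables instead of at the filling.
mergeSum-topFirst : ∀ b (v : Monomial n) (f g : ℕ → Word n) i t →
  let P = applyUpTo f (length v); Q = applyUpTo g (length v) in
  𝟙 ((i ∧ (t ∧ topFirst b P Q)) ∧ (applyUpTo (λ k → merge b (f k) (g k)) (length v) ==ᵐ v))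
    ≡ mergeSum b v (λ p q → 𝟙 (topFirst b p q) * (𝟙 (i ∧ (P ==ᵐ p)) * 𝟙 (t ∧ (Q ==ᵐ q))))
mergeSum-topFirst b v f g false t =
  sym (mergeSum-*0 b v (λ p q → 𝟙 (topFirst b p q)))
mergeSum-topFirst b v f g true false = sym (trans
  (mergeSum-ext b v (λ p q → trans
    (cong (𝟙 (topFirst b p q) *_) (*-zeroʳ (𝟙 (applyUpTo f (length v) ==ᵐ p))))
    (*-zeroʳ (𝟙 (topFirst b p q)))))
  (mergeSum-0 b v))
mergeSum-topFirst {n} b v f g true true = begin
  𝟙 (topFirst b P Q ∧ (R ==ᵐ v))
    ≡⟨ 𝟙-∧ (topFirst b P Q) (R ==ᵐ v) ⟩
  𝟙 (topFirst b P Q) * 𝟙 (R ==ᵐ v)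
    ≡⟨ cong (𝟙 (topFirst b P Q) *_) (mergeSum-unique b v f g) ⟨
  𝟙 (topFirst b P Q) * mergeSum b v (λ p q → 𝟙 (P ==ᵐ p) * 𝟙 (Q ==ᵐ q))
    ≡⟨ mergeSum-𝟙 b v (topFirst b P Q) _ ⟨
  mergeSum b v (λ p q → 𝟙 (topFirst b P Q) * (𝟙 (P ==ᵐ p) * 𝟙 (Q ==ᵐ q)))
    ≡⟨ mergeSum-ext b v transport ⟩
  mergeSum b v (λ p q → 𝟙 (topFirst b p q) * (𝟙 (P ==ᵐ p) * 𝟙 (Q ==ᵐ q))) ∎
  where
  P Q R : Monomial n
  P = applyUpTo f (length v)
  Q = applyUpTo g (length v)
  R = applyUpTo (λ k → merge b (f k) (g k)) (length v)
  transport : ∀ p q → 𝟙 (topFirst b P Q) * (𝟙 (P ==ᵐ p) * 𝟙 (Q ==ᵐ q))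
    ≡ 𝟙 (topFirst b p q) * (𝟙 (P ==ᵐ p) * 𝟙 (Q ==ᵐ q))
  transport p q with P ==ᵐ p in eqP | Q ==ᵐ q in eqQ
  ... | true | true rewrite ==ᵐ⇒≡ P p eqP | ==ᵐ⇒≡ Q q eqQ = refl
  ... | true | false = trans (*-zeroʳ (𝟙 (topFirst b P Q))) (sym (*-zeroʳ (𝟙 (topFirst b p q))))
  ... | false | _ = trans (*-zeroʳ (𝟙 (topFirst b P Q))) (sym (*-zeroʳ (𝟙 (topFirst b p q))))

-- Row and column orders

Rel : Bool → ℕ → ℕ → Set
Rel false = _≤_
Rel true = _<_

rel⇒Rel : ∀ b {x y} → T (rel b x y) → Rel b x y
rel⇒Rel false = ≤ᵇ⇒≤ _ _
rel⇒Rel true = <ᵇ⇒< _ _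

Rel⇒rel : ∀ b {x y} → Rel b x y → T (rel b x y)
Rel⇒rel false = ≤⇒≤ᵇ
Rel⇒rel true = <⇒<ᵇ

Rel⇒≤ : ∀ b {x y} → Rel b x y → x ≤ y
Rel⇒≤ false p = p
Rel⇒≤ true p = <⇒≤ p

Rel-≤-trans : ∀ b {x y z} → Rel b x y → y ≤ z → Rel b x z
Rel-≤-trans false = ≤-trans
Rel-≤-trans true = <-≤-trans

Rel-trans : ∀ b {x y z} → Rel b x y → Rel b y z → Rel b x z
Rel-trans b p q = Rel-≤-trans b p (Rel⇒≤ b q)

Rel-suc : ∀ b {x y} → Rel b x y → Rel b (suc x) (suc y)
Rel-suc false = s≤s
Rel-suc true = s≤s

Rel-pred : ∀ b {x y} → Rel b (suc x) (suc y) → Rel b x y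
Rel-pred false (s≤s p) = p
Rel-pred true (s≤s p) = p

Rel-zero : ∀ b {y} → Rel b 0 (suc y)
Rel-zero false = z≤n
Rel-zero true = s≤s z≤n

-- With `Rel-asym`, this makes `Rel (not b)` the negated converse of `Rel b`. This duality of row
-- and column orders lets one proof serve both kinds of tableau.
Rel-connex : ∀ b x y → Rel b x y ⊎ Rel (not b) y x
Rel-connex false x y = ≤-<-connex x y
Rel-connex true x y with ≤-<-connex y x
... | inj₁ p = inj₂ p
... | inj₂ p = inj₁ p

Rel-asym : ∀ b {x y} → Rel b x y → ¬ Rel (not b) y x
Rel-asym false p q = ≤⇒≯ p q
Rel-asym true p q = ≤⇒≯ q p

increasing-All : ∀ b x xs → T (increasing b (x ∷ xs)) → All (Rel b x) xs
increasing-All b x [] _ = []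
increasing-All b x (y ∷ ys) p rewrite increasing-∷∷ b x y ys with ∧-elim (rel b x y) p
... | x<y , p' = rel⇒Rel b x<y ∷ All.map (Rel-trans b (rel⇒Rel b x<y)) (increasing-All b y ys p')

increasing-tail : ∀ b x xs → T (increasing b (x ∷ xs)) → T (increasing b xs)
increasing-tail b x [] _ rewrite increasing-[] b = tt
increasing-tail b x (y ∷ ys) p rewrite increasing-∷∷ b x y ys = proj₂ (∧-elim (rel b x y) p)

increasing-cons : ∀ b x xs → All (Rel b x) xs → T (increasing b xs) → T (increasing b (x ∷ xs))
increasing-cons b x [] _ _ rewrite increasing-[-] b x = tt
increasing-cons b x (y ∷ ys) (p ∷ _) q rewrite increasing-∷∷ b x y ys = ∧-intro (rel b x y) (Rel⇒rel b p) q

allB-All : (p : X → Bool) (xs : List X) → T (allB p xs) → All (T ∘ p) xs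
allB-All p [] _ = []
allB-All p (x ∷ xs) t with ∧-elim (p x) t
... | px , pxs = px ∷ allB-All p xs pxs

All-allB : (p : X → Bool) {xs : List X} → All (T ∘ p) xs → T (allB p xs)
All-allB p [] = tt
All-allB p {x ∷ _} (px ∷ pxs) = ∧-intro (p x) px (All-allB p pxs)

-- Reduces to `isCIT` for `false` and to `isCRSIT` for `true`.
tableau : Bool → Sentence n → Filling → Bool
tableau b J S =
  hasShape J S ∧ positive S ∧ allB (increasing b) S ∧ increasing (not b) (firstColumn S)

Shape : Sentence n → Filling → Set
Shape J S = map length S ≡ map (λ w → length (toList w)) J

record Tableau (b : Bool) (J : Sentence n) (S : Filling) : Set where
  constructor mkTableau
  field
    shape : Shape J S
    entries≥1 : All (All (1 ≤_)) S
    rows : All (T ∘ increasing b) S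
    column : T (increasing (not b) (firstColumn S))

toTableau : ∀ b (J : Sentence n) S → T (tableau b J S) → Tableau b J S
toTableau b J S t with ∧-elim (hasShape J S) t
... | sh , t₁ with ∧-elim (positive S) t₁
... | po , t₂ with ∧-elim (allB (increasing b) S) t₂
... | ro , co = mkTableau (toWitness sh)
  (All.map (λ {r} p → All.map (≤ᵇ⇒≤ 1 _) (allB-All (1 ≤ᵇ_) r p)) (allB-All _ S po))
  (allB-All (increasing b) S ro) co

fromTableau : ∀ b (J : Sentence n) S → Tableau b J S → T (tableau b J S)
fromTableau b J S (mkTableau sh po ro co) = ∧-intro (hasShape J S) (fromWitness sh) (∧-intro (positive S)
  (All-allB _ (All.map (λ p → All-allB (1 ≤ᵇ_) (All.map ≤⇒≤ᵇ p)) po))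
  (∧-intro (allB (increasing b) S) (All-allB (increasing b) ro) co))

-- Each row is bounded below by its first entry, so a bound on the first column passes to all
-- entries.
column-All : ∀ b e S → All (T ∘ increasing b) S → All (Rel (not b) e) (firstColumn S) →
  All (All (Rel (not b) e)) S
column-All b e [] [] _ = []
column-All b e ([] ∷ S) (_ ∷ ro) co = [] ∷ column-All b e S ro co
column-All b e ((h ∷ r) ∷ S) (p ∷ ro) (e<h ∷ co) =
  (e<h ∷ All.map (λ h≤x → Rel-≤-trans (not b) e<h (Rel⇒≤ b h≤x)) (increasing-All b h r p))
  ∷ column-All b e S ro co

All-column : {P : ℕ → Set} (S : Filling) → All (All P) S → All P (firstColumn S)
All-column [] [] = []
All-column ([] ∷ S) (_ ∷ ps) = All-column S ps
All-column ((h ∷ r) ∷ S) ((p ∷ _) ∷ ps) = p ∷ All-column S ps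

-- Types of fillings and removal of the top row

content : Bool → ℕ → Sentence n → Filling → Word n
content false i J S = coloursOf i (reverse (coloredRows J S))
content true i J S = coloursOf i (coloredRows J S)

typeOf : Bool → ℕ → Sentence n → Filling → Monomial n
typeOf b m J S = applyUpTo (λ k → content b (suc k) J S) m

coloursOf-∷ : ∀ i (w : Word n) r rs → coloursOf i (zip w r ∷ rs) ≡ coloursInRow i w r ++ coloursOf i rs
coloursOf-∷ i [] r rs = refl
coloursOf-∷ i (c ∷ w) [] rs = refl
coloursOf-∷ i (c ∷ w) (e ∷ r) rs with e ≡ᵇ i
... | true = cong (c ∷_) (coloursOf-∷ i w r rs)
... | false = coloursOf-∷ i w r rs

content-∷ : ∀ b i w (J : Sentence n) r S →
  content b i (w ∷ J) (r ∷ S) ≡ merge b (coloursInRow i (toList w) r) (content b i J S)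
content-∷ true i w J r S = coloursOf-∷ i (toList w) r (coloredRows J S)
content-∷ false i w J r S = begin
  coloursOf i (reverse (zip (toList w) r ∷ rs))
    ≡⟨ cong (coloursOf i) (unfold-reverse _ rs) ⟩
  coloursOf i (reverse rs ++ zip (toList w) r ∷ [])
    ≡⟨ concatMap-++ _ (reverse rs) (zip (toList w) r ∷ []) ⟩
  coloursOf i (reverse rs) ++ coloursOf i (zip (toList w) r ∷ [])
    ≡⟨ cong (coloursOf i (reverse rs) ++_) (trans (coloursOf-∷ i (toList w) r []) (++-identityʳ _)) ⟩
  coloursOf i (reverse rs) ++ coloursInRow i (toList w) r ∎
  where rs = coloredRows J S

merge-[] : ∀ b {p q : Word n} → p ≡ [] → q ≡ [] → merge b p q ≡ []
merge-[] false refl refl = refl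
merge-[] true refl refl = refl

merge-conical : ∀ b (p q : Word n) → merge b p q ≡ [] → p ≡ [] × q ≡ []
merge-conical false p q e = ++-conicalʳ q p e , ++-conicalˡ q p e
merge-conical true p q e = ++-conicalˡ p q e , ++-conicalʳ p q e

coloursInRow-[] : ∀ i (w : Word n) r → All (_≢ i) r → coloursInRow i w r ≡ []
coloursInRow-[] i [] r _ = refl
coloursInRow-[] i (c ∷ w) [] _ = refl
coloursInRow-[] i (c ∷ w) (e ∷ r) (e≢i ∷ ps) with e ≡ᵇ i | ≡ᵇ⇒≡ e i
... | true | p = ⊥-elim (e≢i (p tt))
... | false | _ = coloursInRow-[] i w r ps

-- With equal lengths every entry carries a letter, so an entry `i` would show up in the colours.
coloursInRow-[]⁻¹ : ∀ i (w : Word n) r → length r ≡ length w →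
  coloursInRow i w r ≡ [] → All (_≢ i) r
coloursInRow-[]⁻¹ i w [] _ _ = []
coloursInRow-[]⁻¹ i (c ∷ w) (e ∷ r) len p with e ≡ᵇ i | ≡⇒≡ᵇ e i
... | false | q = q ∷ coloursInRow-[]⁻¹ i w r (suc-injective len) p

content-[] : ∀ b i (J : Sentence n) S → All (All (_≢ i)) S → content b i J S ≡ []
content-[] false i [] S _ = refl
content-[] true i [] S _ = refl
content-[] false i (w ∷ J) [] _ = refl
content-[] true i (w ∷ J) [] _ = refl
content-[] b i (w ∷ J) (r ∷ S) (p ∷ ps) = trans (content-∷ b i w J r S)
  (merge-[] b (coloursInRow-[] i (toList w) r p) (content-[] b i J S ps))

content-[]⁻¹ : ∀ b i (J : Sentence n) S → Shape J S → content b i J S ≡ [] → All (All (_≢ i)) S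
content-[]⁻¹ b i [] [] _ _ = []
content-[]⁻¹ b i (w ∷ J) (r ∷ S) sh e
  with ∷-injective sh | merge-conical b _ _ (trans (sym (content-∷ b i w J r S)) e)
... | len , sh' | p , q =
  coloursInRow-[]⁻¹ i (toList w) r len p ∷ content-[]⁻¹ b i J S sh' q

-- `Rel b 0 0` holds exactly for `b = false`, where the first nonempty block of the top row must
-- contain no letter from below.
topFirst-start : ∀ b {u : Word n} x p q → NonNull u →
  T (topFirst b (u ∷ p) (x ∷ q)) ⇔ (Rel b 0 0 → x ≡ [])
topFirst-start b [] p q nonNull = mk⇔ (λ _ _ → refl) (λ _ → tt)
topFirst-start false (_ ∷ _) p q nonNull = mk⇔ (λ ()) (λ e → nonempty (e z≤n))
  where
  nonempty : ∀ {n} {a : Fin n} {u : Word n} → _≡_ {A = Word n} (a ∷ u) [] → T false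
  nonempty ()
topFirst-start true (_ ∷ _) p q nonNull = mk⇔ (λ _ ()) (λ _ → tt)

topFirst-skip : ∀ b {u : Word n} x p q → u ≡ [] →
  T (topFirst b (u ∷ p) (x ∷ q)) ⇔ (x ≡ [] × T (topFirst b p q))
topFirst-skip b [] p q refl = mk⇔ (refl ,_) proj₂
topFirst-skip b (_ ∷ _) p q refl = mk⇔ (λ ()) (λ { (() , _) })

-- Blocks are indexed from 0 here, so block `e` holds the entries `suc e`. The induction skips the
-- empty blocks before it.
topFirst-applyUpTo : ∀ b m e (f g : ℕ → Word n) → e < m →
  (∀ k → k < e → f k ≡ []) → NonNull (f e) →
  T (topFirst b (applyUpTo f m) (applyUpTo g m)) ⇔ (∀ k → Rel b k e → g k ≡ [])
topFirst-applyUpTo b (suc m) zero f g _ _ nn =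
  mk⇔ (λ t k k≤0 → onlyZero b k k≤0 (to t)) (λ h → from (h 0))
  where
  open Equivalence (topFirst-start b (g 0) (applyUpTo (f ∘ suc) m) (applyUpTo (g ∘ suc) m) nn)
  onlyZero : ∀ b k → Rel b k 0 → (Rel b 0 0 → g 0 ≡ []) → g k ≡ []
  onlyZero false zero z≤n h = h z≤n
topFirst-applyUpTo b (suc m) (suc e) f g (s≤s e<m) empty nn = mk⇔
  (λ { t zero _ → proj₁ (to t)
     ; t (suc k) k≤e → Equivalence.to rest (proj₂ (to t)) k (Rel-pred b k≤e) })
  (λ h → from (h 0 (Rel-zero b) , Equivalence.from rest (λ k k≤e → h (suc k) (Rel-suc b k≤e))))
  where
  rest = topFirst-applyUpTo b m e (f ∘ suc) (g ∘ suc) e<m (λ k k<e → empty (suc k) (s≤s k<e)) nn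
  open Equivalence (topFirst-skip b (g 0) (applyUpTo (f ∘ suc) m) (applyUpTo (g ∘ suc) m)
    (empty 0 (s≤s z≤n)))

-- The row increases from `suc e`, so its first nonempty block is block `e`. By the duality of
-- orders, the absence below of the values that `topFirst` forbids is the lower bound on the
-- entries.
topFirst-entries : ∀ b m e es w (J : Sentence n) S → e < m →
  T (increasing b (suc e ∷ es)) → Shape J S → All (All (1 ≤_)) S →
  T (topFirst b (rowType m (toList w) (suc e ∷ es)) (typeOf b m J S))
    ⇔ All (All (Rel (not b) (suc e))) S
topFirst-entries {n} b m e es w@(c ∷ cs) J S e<m inc sh po = mk⇔
  (λ t → All.tabulate (λ {r} r∈S → All.tabulate (λ {x} x∈r →
    exceeds x (All.lookup (All.lookup po r∈S) x∈r)
      (λ k k≤e → All.lookup (All.lookup (content-[]⁻¹ b (suc k) J S sh (to t k k≤e)) r∈S) x∈r))))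
  (λ above → from (λ k k≤e → content-[] b (suc k) J S
    (All.map (All.map (λ { e<x refl → Rel-asym b k≤e (Rel-pred (not b) e<x) })) above)))
  where
  row = suc e ∷ es
  missing : ∀ k → k < e → coloursInRow (suc k) (toList w) row ≡ []
  missing k k<e = coloursInRow-[] (suc k) (toList w) row
    ((λ { refl → ≤⇒≯ ≤-refl k<e }) ∷
     All.map (λ { e≤x refl → ≤⇒≯ (Rel⇒≤ b e≤x) (s≤s k<e) }) (increasing-All b (suc e) es inc))
  present : NonNull (coloursInRow (suc e) (toList w) row)
  present with e ≡ᵇ e | ≡⇒≡ᵇ e e refl
  ... | true | _ = nonNull
  open Equivalence (topFirst-applyUpTo b m e (λ k → coloursInRow (suc k) (toList w) row)
    (λ k → content b (suc k) J S) e<m missing present)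
  exceeds : ∀ x → 1 ≤ x → (∀ k → Rel b k e → x ≢ suc k) → Rel (not b) (suc e) x
  exceeds (suc k) _ p with Rel-connex b k e
  ... | inj₁ k≤e = ⊥-elim (p k k≤e refl)
  ... | inj₂ e<k = Rel-suc (not b) e<k

-- By transitivity along rows and first column, the column condition lost with the top row compares
-- its first entry with all entries below, which the types detect through `topFirst`.
tableau-∷ : ∀ b m (w : List⁺ (Fin n)) J r S → Row (length (toList w)) m r →
  tableau b (w ∷ J) (r ∷ S)
    ≡ increasing b r ∧ (tableau b J S ∧ topFirst b (rowType m (toList w) r) (typeOf b m J S))
tableau-∷ {n} b m w@(_ ∷ _) J r@(suc e ∷ es) S (len , bounds@((_ , e<m) ∷ _)) = T-ext split join
  where
  tf = topFirst b (rowType m (toList w) r) (typeOf b m J S)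
  split : T (tableau b (w ∷ J) (r ∷ S)) → T (increasing b r ∧ (tableau b J S ∧ tf))
  split t with toTableau b (w ∷ J) (r ∷ S) t
  ... | mkTableau sh (_ ∷ po) (inc ∷ ro) co = ∧-intro (increasing b r) inc (∧-intro (tableau b J S)
    (fromTableau b J S (mkTableau sh' po ro (increasing-tail (not b) (suc e) (firstColumn S) co)))
    (Equivalence.from (topFirst-entries b m e es w J S e<m inc sh' po)
      (column-All b (suc e) S ro (increasing-All (not b) (suc e) (firstColumn S) co))))
    where sh' = proj₂ (∷-injective sh)
  join : T (increasing b r ∧ (tableau b J S ∧ tf)) → T (tableau b (w ∷ J) (r ∷ S))
  join t with ∧-elim (increasing b r) t
  ... | inc , t' with ∧-elim (tableau b J S) t'
  ... | tab , first with toTableau b J S tab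
  ... | mkTableau sh po ro co = fromTableau b (w ∷ J) (r ∷ S) (mkTableau
    (cong₂ _∷_ len sh) (All.map proj₁ bounds ∷ po) (inc ∷ ro)
    (increasing-cons (not b) (suc e) (firstColumn S)
      (All-column S (Equivalence.to (topFirst-entries b m e es w J S e<m inc sh po) first)) co))

-- Used with m = length v; m is a separate argument so that v can vary.
tableauSum : Bool → ℕ → Sentence n → Monomial n → ℕ
tableauSum b m J v = ∑ (fillingsUpTo J m) (λ S → 𝟙 (tableau b J S ∧ (typeOf b m J S ==ᵐ v)))

∑-product : (c : ℕ) (f : X → ℕ) (g : Y → ℕ) (xs : List X) (ys : List Y) →
  ∑ xs (λ x → ∑ ys (λ y → c * (f x * g y))) ≡ c * (∑ xs f * ∑ ys g)
∑-product c f g xs ys = begin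
  ∑ xs (λ x → ∑ ys (λ y → c * (f x * g y)))
    ≡⟨ ∑-ext xs (λ x → trans (∑-*ˡ c (λ y → f x * g y) ys) (cong (c *_)
         (trans (∑-*ˡ (f x) g ys) (*-comm (f x) (∑ ys g))))) ⟩
  ∑ xs (λ x → c * (∑ ys g * f x))
    ≡⟨ trans (∑-*ˡ c (λ x → ∑ ys g * f x) xs) (cong (c *_) (∑-*ˡ (∑ ys g) f xs)) ⟩
  c * (∑ ys g * ∑ xs f)
    ≡⟨ cong (c *_) (*-comm (∑ ys g) (∑ xs f)) ⟩
  c * (∑ xs f * ∑ ys g) ∎

-- Once types are summed over, the top row and the rows below interact only through `topFirst`.
tableauSum-∷ : ∀ b w (J : Sentence n) v →
  tableauSum b (length v) (w ∷ J) v
    ≡ mergeSum b v (λ p q → 𝟙 (topFirst b p q)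
        * (rowSum b (length v) (toList w) p * tableauSum b (length v) J q))
tableauSum-∷ {n} b w J v = begin
  tableauSum b m (w ∷ J) v
    ≡⟨ ∑-concatMap (λ r → map (r ∷_) Ss) _ rs ⟩
  ∑ rs (λ r → ∑ (map (r ∷_) Ss) (λ S → 𝟙 (tableau b (w ∷ J) S ∧ (typeOf b m (w ∷ J) S ==ᵐ v))))
    ≡⟨ ∑-cong rs (All.map (λ {r} row → trans (∑-map (r ∷_) _ Ss) (∑-ext Ss (λ S → pointwise r S row)))
         (rowsUpTo-Row (length (toList w)) m)) ⟩
  ∑ rs (λ r → ∑ Ss (λ S → mergeSum b v (λ p q → 𝟙 (topFirst b p q) * (α r p * β S q))))
    ≡⟨ ∑-ext rs (λ r → mergeSum-∑ b v Ss (λ S p q → 𝟙 (topFirst b p q) * (α r p * β S q))) ⟨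
  ∑ rs (λ r → mergeSum b v (λ p q → ∑ Ss (λ S → 𝟙 (topFirst b p q) * (α r p * β S q))))
    ≡⟨ mergeSum-∑ b v rs (λ r p q → ∑ Ss (λ S → 𝟙 (topFirst b p q) * (α r p * β S q))) ⟨
  mergeSum b v (λ p q → ∑ rs (λ r → ∑ Ss (λ S → 𝟙 (topFirst b p q) * (α r p * β S q))))
    ≡⟨ mergeSum-ext b v (λ p q →
         ∑-product (𝟙 (topFirst b p q)) (λ r → α r p) (λ S → β S q) rs Ss) ⟩
  mergeSum b v (λ p q → 𝟙 (topFirst b p q) * (rowSum b m (toList w) p * tableauSum b m J q)) ∎
  where
  m = length v
  rs = rowsUpTo (length (toList w)) m
  Ss = fillingsUpTo J m
  α : List ℕ → Monomial n → ℕ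
  α r p = 𝟙 (increasing b r ∧ (rowType m (toList w) r ==ᵐ p))
  β : Filling → Monomial n → ℕ
  β S q = 𝟙 (tableau b J S ∧ (typeOf b m J S ==ᵐ q))
  pointwise : ∀ r S → Row (length (toList w)) m r →
    𝟙 (tableau b (w ∷ J) (r ∷ S) ∧ (typeOf b m (w ∷ J) (r ∷ S) ==ᵐ v))
      ≡ mergeSum b v (λ p q → 𝟙 (topFirst b p q) * (α r p * β S q))
  pointwise r S row = trans
    (cong₂ (λ x y → 𝟙 (x ∧ (y ==ᵐ v))) (tableau-∷ b m w J r S row)
      (applyUpTo-cong (λ k → content-∷ b (suc k) w J r S) m))
    (mergeSum-topFirst b v (λ k → coloursInRow (suc k) (toList w) r)
      (λ k → content b (suc k) J S) (increasing b r) (tableau b J S))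

-- Induction on the rows. The list `standardTableaux J` does not depend on `b`, which is what pairs
-- the two expansions term by term.
tableauSum-compat : ∀ b (J : Sentence n) v →
  tableauSum b (length v) J v ≡ ∑ (standardTableaux J) (λ s → compat b s v)
tableauSum-compat false [] v = cong (_+ 0) (empty-compat false v)
tableauSum-compat true [] v = cong (_+ 0) (empty-compat true v)
tableauSum-compat {n} b (w ∷ J) v = begin
  tableauSum b (length v) (w ∷ J) v
    ≡⟨ tableauSum-∷ b w J v ⟩
  mergeSum b v (λ p q → 𝟙 (topFirst b p q)
      * (rowSum b (length v) (toList w) p * tableauSum b (length v) J q))
    ≡⟨ mergeSum-cong b v (λ p q lp lq → cong (𝟙 (topFirst b p q) *_)
         (cong₂ _*_ (trans (cong (λ m → rowSum b m (toList w) p) (sym lp)) (rows-compat b (toList w) p))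
                    (trans (cong (λ m → tableauSum b m J q) (sym lq)) (tableauSum-compat b J q)))) ⟩
  mergeSum b v (λ p q → 𝟙 (topFirst b p q)
      * (compat b (unmarked (toList w)) p * ∑ Ss (λ s → compat b s q)))
    ≡⟨ mergeSum-ext b v (λ p q → trans (∑-*ˡ (𝟙 (topFirst b p q)) (λ s → product b (toList w) s p q) Ss)
         (cong (𝟙 (topFirst b p q) *_)
           (∑-*ˡ (compat b (unmarked (toList w)) p) (λ s → compat b s q) Ss))) ⟨
  mergeSum b v (λ p q → ∑ Ss (λ s → 𝟙 (topFirst b p q) * product b (toList w) s p q))
    ≡⟨ mergeSum-∑ b v Ss (λ s p q → 𝟙 (topFirst b p q) * product b (toList w) s p q) ⟩
  ∑ Ss (λ s → mergeSum b v (λ p q → 𝟙 (topFirst b p q) * product b (toList w) s p q))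
    ≡⟨ ∑-ext Ss (λ s → topFirst-product b w s v) ⟩
  ∑ Ss (λ s → ∑ (shuffleTop (toList w) s) (λ t → compat b t v))
    ≡⟨ ∑-concatMap (shuffleTop (toList w)) (λ t → compat b t v) Ss ⟨
  ∑ (standardTableaux (w ∷ J)) (λ s → compat b s v) ∎
  where Ss = standardTableaux J

count-tableaux : ∀ b (J : Sentence n) v →
  count (λ S → tableau b J S ∧ eqMon (typeOf b (length v) J S) v) (fillingsUpTo J (length v))
    ≡ ∑ (standardTableaux J) (λ s → compat b s v)
count-tableaux b J v = trans (count-∑ _ (fillingsUpTo J (length v))) (trans
  (∑-ext (fillingsUpTo J (length v)) (λ S → cong (λ x → 𝟙 (tableau b J S ∧ x))
    (isYes≗does (≡-dec (≡-dec _≟ᶠ_) (typeOf b (length v) J S) v))))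
  (tableauSum-compat b J v))

-- Expansions in the F_I and the theorem

expansion : List (MarkedWord n) → LinComb n
expansion = map (λ s → pos 1 , fromMarked s)

evalF-expansion : (Ss : List (MarkedWord n)) → ∀ v →
  evalF (expansion Ss) v ≡ pos (∑ Ss (λ s → compat false s v))
evalF-expansion [] v = refl
evalF-expansion (s ∷ Ss) v = trans
  (cong₂ ℤ._+_ (trans (ℤₚ.*-identityˡ (F (fromMarked s) v)) (trans (F-compatible (fromMarked s) v)
      (cong (pos ∘ 𝟙) (compatible-toMarked-fromMarked false s v))))
    (evalF-expansion Ss v))
  (sym (ℤₚ.pos-+ (compat false s v) _))

evalF-ψ-expansion : (Ss : List (MarkedWord n)) → ∀ v →
  evalF (ψ (expansion Ss)) v ≡ pos (∑ Ss (λ s → compat true s v))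
evalF-ψ-expansion [] v = refl
evalF-ψ-expansion (s ∷ Ss) v = trans
  (cong₂ ℤ._+_ (trans (ℤₚ.*-identityˡ (F (complement (fromMarked s)) v))
      (trans (F-complement (fromMarked s) v)
             (cong (pos ∘ 𝟙) (compatible-toMarked-fromMarked true s v))))
    (evalF-ψ-expansion Ss v))
  (sym (ℤₚ.pos-+ (compat true s v) _))

-- The first component places 𝔖*_J in the span of the F_I, so that ψ applies to it; the second
-- covers every way of writing it there.
theorem7p23 : (n : ℕ) (J : Sentence n) →
    (Σ[ cs ∈ LinComb n ] (evalF cs ≋ dualImm J))
    × (∀ (cs : LinComb n) → evalF cs ≋ dualImm J → evalF (ψ cs) ≋ rowStrictDualImm J)
theorem7p23 n J = (cs₀ , cs₀≋) , λ cs cs≋ v → begin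
  evalF (ψ cs) v ≡⟨ evalF-ψ cs v ⟩
  -- `Ψ` sees only the series, so `cs` may be exchanged for the explicit `cs₀`.
  Ψ (evalF cs) v ≡⟨ Ψ-cong (λ u → trans (cs≋ u) (sym (cs₀≋ u))) v ⟩
  Ψ (evalF cs₀) v ≡⟨ evalF-ψ cs₀ v ⟨
  evalF (ψ cs₀) v ≡⟨ evalF-ψ-expansion (standardTableaux J) v ⟩
  pos (∑ (standardTableaux J) (λ s → compat true s v)) ≡⟨ cong pos (count-tableaux true J v) ⟨
  rowStrictDualImm J v ∎
  where
  cs₀ = expansion (standardTableaux J)
  cs₀≋ : evalF cs₀ ≋ dualImm J
  cs₀≋ v = trans (evalF-expansion (standardTableaux J) v) (cong pos (sym (count-tableaux false J v)))
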